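{- For every nonnegative integer $n$, $$\sum_{j=-\infty}^{\infty}(-1)^j\,pod(n-3j^2)=\sum_{j=-\infty}^{\infty}p\!\left(\frac n4-\frac{j(3j+1)}{8}\right),$$ where $p(x)=0$ if $x$ is not an integer.
   Context: $p(n)$ denotes the number of (unrestricted) partitions of $n$, with $p(0)=1$. $pod(n)$ denotes the number of partitions of $n$ in which odd parts are distinct and even parts may be repeated, with $pod(0)=1$. Both $p$ and $pod$ are $0$ at negative arguments. -}

module Defs where

open import Data.Integer as ℤ using (ℤ; +_; -[1+_]; 0ℤ; -1ℤ; ∣_∣)
open import Data.List using (List; []; _∷_; length; filter; upTo; cartesianProductWith)
open import Data.List.Membership.Propositional using (_∈_)
open import Data.List.Membership.Propositional.Properties
  using (∈-upTo⁺; ∈-cartesianProductWith⁺; ∈-cartesianProductWith⁻; ∈-filter⁺; ∈-filter⁻)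
open import Data.List.Properties using (∷-injective)
open import Data.List.Relation.Unary.All using (All; []; _∷_; all?; tabulate)
open import Data.List.Relation.Unary.AllPairs using ([]; _∷_)
open import Data.List.Relation.Unary.Any using (here; there)
open import Data.List.Relation.Unary.Linked using (Linked; linked?)
open import Data.List.Relation.Unary.Unique.Propositional using (Unique)
open import Data.List.Relation.Unary.Unique.Propositional.Properties
  using (upTo⁺; cartesianProductWith⁺; filter⁺)
open import Data.Nat using (ℕ; zero; suc; _≤_; _<_; _≥_; s≤s; _≤?_; _≥?_; _≟_)
open import Data.Nat.Divisibility using (_∣_; _∣?_)
open import Data.Nat.ListAction using (sum)
open import Data.Nat.Properties using (≤-refl; ≤-trans; m≤m+n; m≤n+m)
open import Data.Product using (∃-syntax; _×_; _,_; proj₁; proj₂)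
open import Data.Rational using (ℚ; mkℚ)
open import Function.Bundles using (_⇔_; mk⇔)
open import Relation.Binary.PropositionalEquality using (_≡_; refl)
open import Relation.Nullary using (¬_)
open import Relation.Nullary.Decidable using (_×-dec_; ¬?)
open import Relation.Unary using (Decidable)

open import Data.List.Relation.Unary.Unique.DecPropositional _≟_ using (unique?)

IsPartition : ℕ → List ℕ → Set
IsPartition n xs = All (1 ≤_) xs × Linked _≥_ xs × sum xs ≡ n

Odd : ℕ → Set
Odd a = ¬ (2 ∣ a)

odd? : Decidable Odd
odd? a = ¬? (2 ∣? a)

IsPodPartition : ℕ → List ℕ → Set
IsPodPartition n xs = IsPartition n xs × Unique (filter odd? xs)

isPartition? : ∀ n → Decidable (IsPartition n)
isPartition? n xs = all? (1 ≤?_) xs ×-dec linked? _≥?_ xs ×-dec (sum xs ≟ n)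

isPodPartition? : ∀ n → Decidable (IsPodPartition n)
isPodPartition? n xs = isPartition? n xs ×-dec unique? (filter odd? xs)

-- All lists of length at most l with entries at most m, each listed once.
-- Every partition of n occurs in  lists n n ; see  ∈-partitions  below.
lists : (m l : ℕ) → List (List ℕ)
lists m zero    = [] ∷ []
lists m (suc l) = [] ∷ cartesianProductWith _∷_ (upTo (suc m)) (lists m l)

partitions : ℕ → List (List ℕ)
partitions n = filter (isPartition? n) (lists n n)

podPartitions : ℕ → List (List ℕ)
podPartitions n = filter (isPodPartition? n) (lists n n)

pod : ℤ → ℕ
pod (+ n)    = length (podPartitions n)
pod -[1+ _ ] = 0

-- A rational in lowest terms is an integer exactly when its denominator,
-- stored as its predecessor, is 1.
p : ℚ → ℕ
p (mkℚ (+ n)    zero    _) = length (partitions n)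
p (mkℚ -[1+ _ ] zero    _) = 0
p (mkℚ _        (suc _) _) = 0

-1^_ : ℤ → ℤ
-1^ j = -1ℤ ℤ.^ ∣ j ∣

-- Σ_{j=-N}^{N} f j
∑∣j∣≤ : ℕ → (ℤ → ℤ) → ℤ
∑∣j∣≤ zero    f = f 0ℤ
∑∣j∣≤ (suc N) f = ∑∣j∣≤ N f ℤ.+ (f (+ suc N) ℤ.+ f -[1+ N ])

-- The bilateral sum Σ_{j=-∞}^{∞} f j has only finitely many nonzero terms
-- and equals s.
infix 4 ∑ℤ_≈_
∑ℤ_≈_ : (ℤ → ℤ) → ℤ → Set
∑ℤ f ≈ s = ∃[ N ] ((∀ j → N < ∣ j ∣ → f j ≡ 0ℤ) × ∑∣j∣≤ N f ≡ s)

-- The enumerations contain exactly the intended partitions, without repetition,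
-- so their lengths are the intended counts.

lists-unique : ∀ m l → Unique (lists m l)
lists-unique m zero    = [] ∷ []
lists-unique m (suc l) =
  tabulate []≢ ∷ cartesianProductWith⁺ _∷_ ∷-injective (upTo⁺ (suc m)) (lists-unique m l)
  where
  []≢ : ∀ {xs} → xs ∈ cartesianProductWith _∷_ (upTo (suc m)) (lists m l) → ¬ ([] ≡ xs)
  []≢ xs∈ refl with ∈-cartesianProductWith⁻ _∷_ (upTo (suc m)) (lists m l) xs∈
  ... | _ , _ , _ , _ , ()

∈-lists : ∀ {m l xs} → All (1 ≤_) xs → sum xs ≤ m → sum xs ≤ l → xs ∈ lists m l
∈-lists {l = zero}  []         _   _   = here refl
∈-lists {l = suc _} []         _   _   = here refl
∈-lists {l = zero}  (s≤s _ ∷ _) _  ()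
∈-lists {l = suc l} {suc x ∷ xs} (s≤s _ ∷ pos) s≤m (s≤s s≤l) =
  there (∈-cartesianProductWith⁺ _∷_
    (∈-upTo⁺ (s≤s (≤-trans (m≤m+n (suc x) (sum xs)) s≤m)))
    (∈-lists pos (≤-trans (m≤n+m (sum xs) (suc x)) s≤m)
                 (≤-trans (m≤n+m (sum xs) x) s≤l)))

partition∈lists : ∀ {n xs} → IsPartition n xs → xs ∈ lists n n
partition∈lists (pos , _ , refl) = ∈-lists pos ≤-refl ≤-refl

∈-partitions : ∀ n xs → xs ∈ partitions n ⇔ IsPartition n xs
∈-partitions n xs = mk⇔
  (λ xs∈ → proj₂ (∈-filter⁻ (isPartition? n) {xs = lists n n} xs∈))
  (λ q → ∈-filter⁺ (isPartition? n) (partition∈lists q) q)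

partitions-unique : ∀ n → Unique (partitions n)
partitions-unique n = filter⁺ (isPartition? n) (lists-unique n n)

∈-podPartitions : ∀ n xs → xs ∈ podPartitions n ⇔ IsPodPartition n xs
∈-podPartitions n xs = mk⇔
  (λ xs∈ → proj₂ (∈-filter⁻ (isPodPartition? n) {xs = lists n n} xs∈))
  (λ q → ∈-filter⁺ (isPodPartition? n) (partition∈lists (proj₁ q)) q)

podPartitions-unique : ∀ n → Unique (podPartitions n)
podPartitions-unique n = filter⁺ (isPodPartition? n) (lists-unique n n)

{-# OPTIONS --safe #-}
module Submission where

-- With POD and P the generating functions of pod and p, the claim is
--   POD(q) Σ_j (-1)^j q^(3j²) = P(q⁴) Σ_j q^(j(3j+1)/2).
-- Both bilateral sums are products by the Jacobi triple product; the products
-- agree because (-q; q²)/(q²; q²) = (-q; q)/(q⁴; q⁴) and, with x = q³,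
-- (-x; x)(x; x²)²(x²; x²) = (x; x).
-- Only one coefficient is ever needed, so everything takes place in a commutative
-- ring where q is nilpotent: infinite products become finite ones, and the triple
-- product follows from its finite form, as every Gaussian binomial times (x; x)
-- acts as 1 on the monomial it multiplies.

open import Defs
open import Algebra.Bundles using (CommutativeRing)
import Algebra.Properties.CommutativeSemiring.Exp
import Algebra.Properties.Ring
import Algebra.Solver.Ring.NaturalCoefficients.Default
open import Data.Integer as ℤ using (ℤ; +_; -[1+_]; 0ℤ; 1ℤ; -1ℤ; ∣_∣)
import Data.Integer.Properties as ℤ
import Data.Integer.Tactic.RingSolver as ℤ-Solver
open import Data.List using (List; []; _∷_; _++_; length; filter; map)
open import Data.List.Membership.Propositional using (_∈_)
open import Data.List.Membership.Propositional.Properties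
  using (∈-filter⁺; ∈-filter⁻; ∈-++⁺ˡ; ∈-++⁺ʳ; ∈-++⁻; ∈-map⁺; ∈-map⁻)
open import Data.List.Membership.Propositional.Properties.WithK using (unique∧set⇒bag)
open import Data.List.Properties
  using (length-++; length-map; filter-accept; filter-reject; filter-none; ∷-injectiveʳ)
open import Data.List.Relation.Binary.BagAndSetEquality using (∼bag⇒↭)
open import Data.List.Relation.Binary.Permutation.Propositional.Properties using (↭-length)
open import Data.List.Relation.Unary.All as All using (All; []; _∷_; all?)
open import Data.List.Relation.Unary.AllPairs as AllPairs using ([]; _∷_)
open import Data.List.Relation.Unary.Any using (here)
open import Data.List.Relation.Unary.Linked using (Linked; []; [-]; _∷_)
open import Data.List.Relation.Unary.Linked.Properties using (Linked⇒AllPairs)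
open import Data.List.Relation.Unary.Unique.Propositional using (Unique)
open import Data.List.Relation.Unary.Unique.Propositional.Properties using (filter⁺; map⁺; ++⁺)
import Data.Nat.Coprimality as Coprime
open import Data.Nat as ℕ using (ℕ; zero; suc; _≤_; _<_; _≥_; z≤n; s≤s; _≤?_; _≟_)
open import Data.Nat.Divisibility using (_∣_; n∣m*n; ∣m+n∣m⇒∣n; ∣1⇒≡1)
open import Data.Nat.ListAction using (sum)
import Data.Nat.Properties as ℕ
import Data.Nat.Tactic.RingSolver as ℕ-Solver
open import Data.Product using (_×_; _,_; proj₁; proj₂; ∃-syntax)
open import Data.Rational as ℚ using (ℚ; mkℚ; toℚᵘ)
import Data.Rational.Properties as ℚ
open import Data.Rational.Unnormalised as ℚᵘ using (mkℚᵘ; *≡*; _≃_)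
import Data.Rational.Unnormalised.Properties as ℚᵘ
open import Data.Sum as Sum using (_⊎_; inj₁; inj₂)
open import Function.Base using (_∘_)
open import Function.Bundles using (mk⇔; module Equivalence)
open import Level using (0ℓ)
open import Relation.Binary.PropositionalEquality as ≡ using (_≡_; _≗_)
import Relation.Binary.Reasoning.Setoid
open import Relation.Nullary using (¬_; yes; no; contradiction)
open import Relation.Nullary.Decidable using (_×-dec_)
open import Data.Empty using (⊥)
open import Relation.Unary using (Decidable)
open import Relation.Unary.Properties using (∅?)
open import Data.List.Relation.Unary.Unique.DecPropositional _≟_ using (unique?)

-- The Jacobi triple product

-- The triple product is used in Ramanujan's symmetric form: the bilateral sum of a^(j(j+1)/2)
-- b^(j(j-1)/2) equals (x; x)(-a; x)(-b; x) with x = ab. No variable is ever inverted, which is what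
-- makes the statement meaningful for nilpotent a and b. The choice a = b = -q³ yields (-1)^j
-- q^(3j²), and a = q², b = q yields q^(j(3j+1)/2). The two products meet in (-q; q). Sorted by
-- residues modulo 3 it is (-q; q³)(-q²; q³)(-q³; q³): two of these factors belong to the second
-- theta function, and the remaining one is the (-x; x) that the first theta product needs. P
-- appears at q⁴ because n/4 - j(3j+1)/8 = (n - j(3j+1)/2)/4. Quotients are never formed: a series f
-- that should be E/K enters through the equation f K = E, and such equations come from recurrences
-- on partitions with bounded parts.

triangle : ℕ → ℕ
triangle zero    = 0
triangle (suc n) = n ℕ.+ triangle n

-- `triangle i` is i(i - 1)/2, one step behind the usual triangular number; its double therefore
-- falls short of the square by exactly i.
i+2triangle : ∀ i → i ℕ.+ (triangle i ℕ.+ triangle i) ≡ i ℕ.* i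
i+2triangle zero    = ≡.refl
i+2triangle (suc i) = ≡.trans (lemma i (triangle i))
  (≡.trans (≡.cong (λ m → suc (i ℕ.+ (i ℕ.+ m))) (i+2triangle i)) (lemma′ i))
  where
  lemma : ∀ i t → suc i ℕ.+ (i ℕ.+ t ℕ.+ (i ℕ.+ t)) ≡ suc (i ℕ.+ (i ℕ.+ (i ℕ.+ (t ℕ.+ t))))
  lemma = ℕ-Solver.solve-∀
  lemma′ : ∀ i → suc (i ℕ.+ (i ℕ.+ i ℕ.* i)) ≡ suc i ℕ.* suc i
  lemma′ = ℕ-Solver.solve-∀

module QSeries {c ℓ} (R : CommutativeRing c ℓ) where

  open CommutativeRing R hiding (zero)
  open Algebra.Properties.Ring ring
  open Algebra.Properties.CommutativeSemiring.Exp commutativeSemiring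
  open Algebra.Solver.Ring.NaturalCoefficients.Default commutativeSemiring
    using (solve; _:=_; _:+_; _:*_; con)
  open Relation.Binary.Reasoning.Setoid setoid

  -- The q-Pochhammer symbol (-c; x)_n: note the sign.
  poch : Carrier → Carrier → ℕ → Carrier
  poch c x zero    = 1#
  poch c x (suc n) = poch c x n * (1# + c * x ^ n)

  poch-cong : ∀ {c d x y} → c ≈ d → x ≈ y → ∀ n → poch c x n ≈ poch d y n
  poch-cong c≈d x≈y zero    = refl
  poch-cong c≈d x≈y (suc n) =
    *-cong (poch-cong c≈d x≈y n) (+-congˡ (*-cong c≈d (^-congˡ n x≈y)))

  poch-peelˡ : ∀ c x n → poch c x (suc n) ≈ (1# + c) * poch (c * x) x n
  poch-peelˡ c x zero    = solve 1 (λ c → con 1 :* (con 1 :+ c :* con 1) := (con 1 :+ c) :* con 1) refl c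
  poch-peelˡ c x (suc n) = begin
    poch c x (suc n) * (1# + c * (x * x ^ n))                  ≈⟨ *-cong (poch-peelˡ c x n) (+-congˡ (sym (*-assoc c x _))) ⟩
    (1# + c) * poch (c * x) x n * (1# + c * x * x ^ n)         ≈⟨ *-assoc _ _ _ ⟩
    (1# + c) * (poch (c * x) x n * (1# + c * x * x ^ n))       ∎

  poch-split₂ : ∀ c x n → poch c x (n ℕ.* 2) ≈ poch c (x * x) n * poch (c * x) (x * x) n
  poch-split₂ c x zero    = sym (*-identityˡ 1#)
  poch-split₂ c x (suc n) = begin
    poch c x (n ℕ.* 2) * (1# + c * x ^ (n ℕ.* 2)) * (1# + c * (x * x ^ (n ℕ.* 2)))
      ≈⟨ *-cong (*-cong (poch-split₂ c x n) (+-congˡ (*-congˡ pow))) (+-congˡ (*-congˡ (*-congˡ pow))) ⟩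
    P * Q * (1# + c * X) * (1# + c * (x * X))
      ≈⟨ solve 5 (λ P Q X c x → P :* Q :* (con 1 :+ c :* X) :* (con 1 :+ c :* (x :* X))
           := P :* (con 1 :+ c :* X) :* (Q :* (con 1 :+ c :* x :* X))) refl P Q X c x ⟩
    P * (1# + c * X) * (Q * (1# + c * x * X)) ∎
    where
    P = poch c (x * x) n
    Q = poch (c * x) (x * x) n
    X = (x * x) ^ n
    pow : x ^ (n ℕ.* 2) ≈ X
    pow = begin
      x ^ (n ℕ.* 2)   ≈⟨ ^-congʳ x (ℕ.*-comm n 2) ⟩
      x ^ (2 ℕ.* n)   ≈⟨ ^-assocʳ x 2 n ⟨
      (x ^ 2) ^ n     ≈⟨ ^-congˡ n (*-congˡ (*-identityʳ x)) ⟩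
      X               ∎

  poch-split₃ : ∀ c x n → let y = x * (x * x) in
    poch c x (n ℕ.* 3) ≈ poch c y n * poch (c * x) y n * poch (c * (x * x)) y n
  poch-split₃ c x zero    = solve 0 (con 1 := con 1 :* con 1 :* con 1) refl
  poch-split₃ c x (suc n) = begin
    poch c x (n ℕ.* 3) * (1# + c * x ^ (n ℕ.* 3)) * (1# + c * (x * x ^ (n ℕ.* 3))) * (1# + c * (x * (x * x ^ (n ℕ.* 3))))
      ≈⟨ *-cong (*-cong (*-cong (poch-split₃ c x n) (+-congˡ (*-congˡ pow)))
           (+-congˡ (*-congˡ (*-congˡ pow)))) (+-congˡ (*-congˡ (*-congˡ (*-congˡ pow)))) ⟩
    P * Q * S * (1# + c * X) * (1# + c * (x * X)) * (1# + c * (x * (x * X)))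
      ≈⟨ solve 6 (λ P Q S X c x →
           P :* Q :* S :* (con 1 :+ c :* X) :* (con 1 :+ c :* (x :* X)) :* (con 1 :+ c :* (x :* (x :* X)))
           := P :* (con 1 :+ c :* X) :* (Q :* (con 1 :+ c :* x :* X)) :* (S :* (con 1 :+ c :* (x :* x) :* X)))
           refl P Q S X c x ⟩
    P * (1# + c * X) * (Q * (1# + c * x * X)) * (S * (1# + c * (x * x) * X)) ∎
    where
    y = x * (x * x)
    P = poch c y n
    Q = poch (c * x) y n
    S = poch (c * (x * x)) y n
    X = y ^ n
    pow : x ^ (n ℕ.* 3) ≈ X
    pow = begin
      x ^ (n ℕ.* 3)   ≈⟨ ^-congʳ x (ℕ.*-comm n 3) ⟩
      x ^ (3 ℕ.* n)   ≈⟨ ^-assocʳ x 3 n ⟨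
      (x ^ 3) ^ n     ≈⟨ ^-congˡ n (*-congˡ (*-congˡ (*-identityʳ x))) ⟩
      X               ∎

  [-x][-y]≈xy : ∀ x y → - x * - y ≈ x * y
  [-x][-y]≈xy x y = begin
    - x * - y      ≈⟨ -‿distribˡ-* x (- y) ⟨
    - (x * - y)    ≈⟨ -‿cong (-‿distribʳ-* x y) ⟨
    - (- (x * y))  ≈⟨ -‿involutive (x * y) ⟩
    x * y          ∎

  [1-x][1+x]≈1-x² : ∀ x → (1# + - x) * (1# + x) ≈ 1# + - (x * x)
  [1-x][1+x]≈1-x² x = begin
    (1# + - x) * (1# + x)                  ≈⟨ distribˡ _ 1# x ⟩
    (1# + - x) * 1# + (1# + - x) * x       ≈⟨ +-cong (*-identityʳ _) (distribʳ x 1# (- x)) ⟩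
    1# + - x + (1# * x + - x * x)          ≈⟨ +-cong refl (+-cong (*-identityˡ x) (sym (-‿distribˡ-* x x))) ⟩
    1# + - x + (x + - (x * x))             ≈⟨ solve 3 (λ u x v → con 1 :+ u :+ (x :+ v) := con 1 :+ v :+ (u :+ x)) refl (- x) x (- (x * x)) ⟩
    1# + - (x * x) + (- x + x)             ≈⟨ +-congˡ (-‿inverseˡ x) ⟩
    1# + - (x * x) + 0#                    ≈⟨ +-identityʳ _ ⟩
    1# + - (x * x)                         ∎

  -- In the sign convention of `poch` this is (x; x)(-x; x) = (x²; x²), obtained factor by factor
  -- from (1 - u)(1 + u) = 1 - u².
  poch-negˡ : ∀ x n → poch (- x) x n * poch x x n ≈ poch (- (x * x)) (x * x) n
  poch-negˡ x zero    = *-identityˡ 1#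
  poch-negˡ x (suc n) = begin
    poch (- x) x n * (1# + - x * x ^ n) * (poch x x n * (1# + x * x ^ n))
      ≈⟨ solve 4 (λ p u q v → p :* u :* (q :* v) := p :* q :* (u :* v)) refl _ _ _ _ ⟩
    poch (- x) x n * poch x x n * ((1# + - x * x ^ n) * (1# + x * x ^ n))
      ≈⟨ *-cong (poch-negˡ x n) (*-congʳ (+-congˡ (sym (-‿distribˡ-* x (x ^ n))))) ⟩
    poch (- (x * x)) (x * x) n * ((1# + - (x * x ^ n)) * (1# + x * x ^ n))
      ≈⟨ *-congˡ ([1-x][1+x]≈1-x² _) ⟩
    poch (- (x * x)) (x * x) n * (1# + - (x * x ^ n * (x * x ^ n)))
      ≈⟨ *-congˡ (+-congˡ (trans (-‿cong pow) (-‿distribˡ-* _ _))) ⟩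
    poch (- (x * x)) (x * x) n * (1# + - (x * x) * (x * x) ^ n) ∎
    where
    pow : x * x ^ n * (x * x ^ n) ≈ x * x * (x * x) ^ n
    pow = begin
      x * x ^ n * (x * x ^ n)     ≈⟨ solve 2 (λ x y → x :* y :* (x :* y) := x :* x :* (y :* y)) refl x (x ^ n) ⟩
      x * x * (x ^ n * x ^ n)     ≈⟨ *-congˡ (^-distrib-* x x n) ⟨
      x * x * (x * x) ^ n         ∎

  -- The division-free form of c n = P n / (x; x)_n. The recurrence says (1 - x^(n+1)) c (n+1) = c n
  -- * r n, so the product telescopes. Counting partitions by largest part gives exactly such a
  -- recurrence: the term with `c (suc n)` on the right stands for one more copy of a repeatable
  -- part.
  poch-quotient : ∀ x (c P r : ℕ → Carrier) → c 0 ≈ P 0 →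
    (∀ n → P (suc n) ≈ P n * r n) →
    (∀ n → c (suc n) ≈ c n * r n + x * x ^ n * c (suc n)) →
    ∀ n → c n * poch (- x) x n ≈ P n
  poch-quotient x c P r c₀ hP hc zero    = trans (*-identityʳ _) c₀
  poch-quotient x c P r c₀ hP hc (suc n) = begin
    c (suc n) * (K * (1# + - x * x ^ n))      ≈⟨ *-congˡ (*-congˡ (+-congˡ (-‿distribˡ-* x (x ^ n)))) ⟨
    c (suc n) * (K * (1# + - u))              ≈⟨ solve 3 (λ c K v → c :* (K :* (con 1 :+ v)) := (c :+ c :* v) :* K) refl _ _ _ ⟩
    (c (suc n) + c (suc n) * - u) * K         ≈⟨ *-congʳ (+-cong (hc n) (trans (sym (-‿distribʳ-* _ u)) (-‿cong (*-comm _ u)))) ⟩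
    (c n * r n + u * c (suc n) + - (u * c (suc n))) * K
                                              ≈⟨ *-congʳ (trans (+-assoc _ _ _) (trans (+-congˡ (-‿inverseʳ _)) (+-identityʳ _))) ⟩
    c n * r n * K                             ≈⟨ solve 3 (λ c r K → c :* r :* K := c :* K :* r) refl _ _ _ ⟩
    c n * K * r n                             ≈⟨ *-congʳ (poch-quotient x c P r c₀ hP hc n) ⟩
    P n * r n                                 ≈⟨ hP n ⟨
    P (suc n)                                 ∎
    where
    K = poch (- x) x n
    u = x * x ^ n

  x^m≈0⇒x^[m+d]≈0 : ∀ x m d → x ^ m ≈ 0# → x ^ (m ℕ.+ d) ≈ 0#
  x^m≈0⇒x^[m+d]≈0 x m d h = begin
    x ^ (m ℕ.+ d)    ≈⟨ ^-homo-* x m d ⟩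
    x ^ m * x ^ d    ≈⟨ *-congʳ h ⟩
    0# * x ^ d       ≈⟨ zeroˡ _ ⟩
    0#               ∎

  -- The factors beyond the n-th act as 1 on w.
  poch-absorb : ∀ w c x n d → w * (c * x ^ n) ≈ 0# → w * poch c x (n ℕ.+ d) ≈ w * poch c x n
  poch-absorb w c x n zero    h = *-congˡ (reflexive (≡.cong (poch c x) (ℕ.+-identityʳ n)))
  poch-absorb w c x n (suc d) h = begin
    w * poch c x (n ℕ.+ suc d)                              ≡⟨ ≡.cong (λ k → w * poch c x k) (ℕ.+-suc n d) ⟩
    w * (poch c x (n ℕ.+ d) * (1# + c * x ^ (n ℕ.+ d)))     ≈⟨ *-congˡ (*-congˡ (+-congˡ (*-congˡ (^-homo-* x n d)))) ⟩
    w * (poch c x (n ℕ.+ d) * (1# + c * (x ^ n * x ^ d)))   ≈⟨ solve 5 (λ w p c y z → w :* (p :* (con 1 :+ c :* (y :* z)))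
                                                                 := w :* p :+ p :* z :* (w :* (c :* y))) refl w _ c (x ^ n) (x ^ d) ⟩
    w * poch c x (n ℕ.+ d) + poch c x (n ℕ.+ d) * x ^ d * (w * (c * x ^ n))
                                                            ≈⟨ +-cong (poch-absorb w c x n d h) (trans (*-congˡ h) (zeroʳ _)) ⟩
    w * poch c x n + 0#                                     ≈⟨ +-identityʳ _ ⟩
    w * poch c x n                                          ∎

  poch-stable : ∀ c x n d → x ^ n ≈ 0# → poch c x (n ℕ.+ d) ≈ poch c x n
  poch-stable c x n d h = begin
    poch c x (n ℕ.+ d)        ≈⟨ *-identityˡ _ ⟨
    1# * poch c x (n ℕ.+ d)   ≈⟨ poch-absorb 1# c x n d (trans (*-identityˡ _) (trans (*-congˡ h) (zeroʳ c))) ⟩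
    1# * poch c x n           ≈⟨ *-identityˡ _ ⟩
    poch c x n                ∎

  -- The Gaussian binomial [k + l choose k], indexed so that no subtraction occurs.
  gauss : Carrier → ℕ → ℕ → Carrier
  gauss x zero    l       = 1#
  gauss x (suc k) zero    = 1#
  gauss x (suc k) (suc l) = gauss x k (suc l) + x ^ suc k * gauss x (suc k) l

  gauss-zeroʳ : ∀ x k → gauss x k 0 ≈ 1#
  gauss-zeroʳ x zero    = refl
  gauss-zeroʳ x (suc k) = refl

  -- The second q-Pascal rule, mirror image of the defining one. The expansion needs both: this rule
  -- adds a factor in a, the defining rule a factor in b. It also makes `gauss` symmetric.
  gauss-pascal : ∀ x k l →
    gauss x (suc k) (suc l) ≈ x ^ suc l * gauss x k (suc l) + gauss x (suc k) l
  gauss-pascal x zero    zero    = +-comm 1# _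
  gauss-pascal x zero    (suc l) = begin
    1# + x ^ 1 * gauss x 1 (suc l)           ≈⟨ +-congˡ (*-congˡ (gauss-pascal x 0 l)) ⟩
    1# + x ^ 1 * (x ^ suc l * 1# + gauss x 1 l)
      ≈⟨ solve 3 (λ x y g → con 1 :+ x :* con 1 :* (y :* con 1 :+ g) := x :* y :* con 1 :+ (con 1 :+ x :* con 1 :* g))
           refl x (x ^ suc l) (gauss x 1 l) ⟩
    x ^ suc (suc l) * 1# + gauss x 1 (suc l) ∎
  gauss-pascal x (suc k) zero    = begin
    gauss x (suc k) 1 + x ^ suc (suc k) * 1#            ≈⟨ +-congʳ (gauss-pascal x k 0) ⟩
    x ^ 1 * gauss x k 1 + gauss x (suc k) 0 + x ^ suc (suc k) * 1#
      ≈⟨ solve 3 (λ x g y → x :* con 1 :* g :+ con 1 :+ x :* y :* con 1 := x :* con 1 :* (g :+ y :* con 1) :+ con 1)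
           refl x (gauss x k 1) (x ^ suc k) ⟩
    x ^ 1 * gauss x (suc k) 1 + 1#                      ∎
  gauss-pascal x (suc k) (suc l) = begin
    gauss x (suc k) (2 ℕ.+ l) + x ^ (2 ℕ.+ k) * gauss x (2 ℕ.+ k) (suc l)
      ≈⟨ +-cong (gauss-pascal x k (suc l)) (*-congˡ (gauss-pascal x (suc k) l)) ⟩
    x ^ (2 ℕ.+ l) * gauss x k (2 ℕ.+ l) + gauss x (suc k) (suc l) + x ^ (2 ℕ.+ k) * (x ^ suc l * gauss x (suc k) (suc l) + gauss x (2 ℕ.+ k) l)
      ≈⟨ solve 6 (λ x K L g h i → x :* L :* g :+ h :+ x :* K :* (L :* h :+ i)
                                 := x :* L :* (g :+ K :* h) :+ (h :+ x :* K :* i)) refl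
           x (x ^ suc k) (x ^ suc l) (gauss x k (2 ℕ.+ l)) (gauss x (suc k) (suc l)) (gauss x (2 ℕ.+ k) l) ⟩
    x ^ (2 ℕ.+ l) * gauss x (suc k) (2 ℕ.+ l) + gauss x (2 ℕ.+ k) (suc l) ∎

  gauss-comm : ∀ x k l → gauss x k l ≈ gauss x l k
  gauss-comm x zero    l       = sym (gauss-zeroʳ x l)
  gauss-comm x (suc k) zero    = refl
  gauss-comm x (suc k) (suc l) = begin
    gauss x k (suc l) + x ^ suc k * gauss x (suc k) l    ≈⟨ +-cong (gauss-comm x k (suc l)) (*-congˡ (gauss-comm x (suc k) l)) ⟩
    gauss x (suc l) k + x ^ suc k * gauss x l (suc k)    ≈⟨ +-comm _ _ ⟩
    x ^ suc k * gauss x l (suc k) + gauss x (suc l) k    ≈⟨ gauss-pascal x l k ⟨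
    gauss x (suc l) (suc k)                              ∎

  -- The product formula for the Gaussian binomial with its denominator cleared. Both summands of
  -- the recurrence acquire the common factor `Q`, and (1 - K) + K(1 - L) = 1 - KL remains.
  gauss-poch : ∀ x k l → gauss x k l * poch (- x) x k ≈ poch (- x ^ suc l) x k
  gauss-poch x zero    l       = *-identityˡ 1#
  gauss-poch x (suc k) zero    = trans (*-identityˡ _) (poch-cong (-‿cong (sym (*-identityʳ x))) refl (suc k))
  gauss-poch x (suc k) (suc l) = begin
    (gauss x k (suc l) + x ^ suc k * gauss x (suc k) l) * (P * (1# + - x * x ^ k))
      ≈⟨ solve 5 (λ g y h P v → (g :+ y :* h) :* (P :* v) := v :* (g :* P) :+ y :* (h :* (P :* v))) refl
           (gauss x k (suc l)) (x ^ suc k) (gauss x (suc k) l) P (1# + - x * x ^ k) ⟩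
    (1# + - x * x ^ k) * (gauss x k (suc l) * P) + x ^ suc k * (gauss x (suc k) l * poch (- x) x (suc k))
      ≈⟨ +-cong (*-cong (+-congˡ (sym (-‿distribˡ-* x _))) (gauss-poch x k (suc l))) (*-congˡ (gauss-poch x (suc k) l)) ⟩
    (1# + - K) * Q + K * poch (- L) x (suc k)
      ≈⟨ +-congˡ (*-congˡ (trans (poch-peelˡ (- L) x k) (*-congˡ (poch-cong Lx refl k)))) ⟩
    (1# + - K) * Q + K * ((1# + - L) * Q)
      ≈⟨ solve 4 (λ K' Q K L' → (con 1 :+ K') :* Q :+ K :* ((con 1 :+ L') :* Q) := Q :* ((con 1 :+ K :* L') :+ (K' :+ K))) refl
           (- K) Q K (- L) ⟩
    Q * ((1# + K * - L) + (- K + K))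
      ≈⟨ *-congˡ (trans (+-congˡ (-‿inverseˡ K)) (+-identityʳ _)) ⟩
    Q * (1# + K * - L)
      ≈⟨ *-congˡ (+-congˡ (trans (sym (-‿distribʳ-* K L)) (trans (-‿cong KL) (-‿distribˡ-* _ _)))) ⟩
    Q * (1# + - x ^ suc (suc l) * x ^ k) ∎
    where
    P = poch (- x) x k
    K = x ^ suc k
    L = x ^ suc l
    Q = poch (- x ^ suc (suc l)) x k
    Lx : - L * x ≈ - (x * L)
    Lx = trans (sym (-‿distribˡ-* L x)) (-‿cong (*-comm L x))
    KL : K * L ≈ x * L * x ^ k
    KL = solve 3 (λ x k l → x :* k :* (x :* l) := x :* (x :* l) :* k) refl x (x ^ k) (x ^ l)

  -- Sums over the antidiagonal k + l = N, and bilateral sums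

  Σ₊ : ℕ → (ℕ → ℕ → Carrier) → Carrier
  Σ₊ zero    F = F 0 0
  Σ₊ (suc N) F = F 0 (suc N) + Σ₊ N (λ k l → F (suc k) l)

  Σ₊-cong : ∀ N {F G} → (∀ k l → k ℕ.+ l ≡ N → F k l ≈ G k l) → Σ₊ N F ≈ Σ₊ N G
  Σ₊-cong zero    h = h 0 0 ≡.refl
  Σ₊-cong (suc N) h = +-cong (h 0 (suc N) ≡.refl) (Σ₊-cong N (λ k l e → h (suc k) l (≡.cong suc e)))

  Σ₊-+ : ∀ N F G → Σ₊ N (λ k l → F k l + G k l) ≈ Σ₊ N F + Σ₊ N G
  Σ₊-+ zero    F G = refl
  Σ₊-+ (suc N) F G = begin
    F 0 (suc N) + G 0 (suc N) + Σ₊ N (λ k l → F (suc k) l + G (suc k) l)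
      ≈⟨ +-congˡ (Σ₊-+ N (λ k → F (suc k)) (λ k → G (suc k))) ⟩
    F 0 (suc N) + G 0 (suc N) + (Σ₊ N (λ k → F (suc k)) + Σ₊ N (λ k → G (suc k)))
      ≈⟨ solve 4 (λ a b c d → a :+ b :+ (c :+ d) := a :+ c :+ (b :+ d)) refl _ _ _ _ ⟩
    Σ₊ (suc N) F + Σ₊ (suc N) G ∎

  *-Σ₊ : ∀ N c F → c * Σ₊ N F ≈ Σ₊ N (λ k l → c * F k l)
  *-Σ₊ zero    c F = refl
  *-Σ₊ (suc N) c F = trans (distribˡ c _ _) (+-congˡ (*-Σ₊ N c (λ k → F (suc k))))

  Σ₊-peelʳ : ∀ N F → Σ₊ (suc N) F ≈ Σ₊ N (λ k l → F k (suc l)) + F (suc N) 0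
  Σ₊-peelʳ zero    F = refl
  Σ₊-peelʳ (suc N) F = trans (+-congˡ (Σ₊-peelʳ N (λ k → F (suc k)))) (sym (+-assoc _ _ _))

  module Pascal (F A B : ℕ → ℕ → Carrier) where

    private
      A′ B′ : ℕ → ℕ → Carrier
      A′ k zero    = 0#
      A′ k (suc l) = A k l
      B′ zero    l = 0#
      B′ (suc k) l = B k l

    -- Extending `A` and `B` by zero beyond the boundary lets the two end terms obey the same rule
    -- as the inner ones; each extended sum then sheds its zero end term.
    Σ₊-pascal : ∀ N →
      (∀ l → F 0 (suc l) ≈ A 0 l) →
      (∀ k → F (suc k) 0 ≈ B k 0) →
      (∀ k l → suc k ℕ.+ l ≡ N → F (suc k) (suc l) ≈ A (suc k) l + B k (suc l)) →
      Σ₊ (suc N) F ≈ Σ₊ N A + Σ₊ N B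
    Σ₊-pascal N hˡ hʳ h = begin
      Σ₊ (suc N) F                                ≈⟨ Σ₊-cong (suc N) F≈ ⟩
      Σ₊ (suc N) (λ k l → A′ k l + B′ k l)        ≈⟨ Σ₊-+ (suc N) A′ B′ ⟩
      Σ₊ (suc N) A′ + Σ₊ (suc N) B′               ≈⟨ +-cong (trans (Σ₊-peelʳ N A′) (+-identityʳ _)) (+-identityˡ _) ⟩
      Σ₊ N A + Σ₊ N B                             ∎
      where
      F≈ : ∀ k l → k ℕ.+ l ≡ suc N → F k l ≈ A′ k l + B′ k l
      F≈ zero    (suc l) e = trans (hˡ l) (sym (+-identityʳ _))
      F≈ (suc k) zero    e = trans (hʳ k) (sym (+-identityˡ _))
      F≈ (suc k) (suc l) e = h k l (≡.trans (≡.sym (ℕ.+-suc k l)) (ℕ.suc-injective e))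

  open Pascal using (Σ₊-pascal)

  -- Index 0 is counted once, through `f⁺`. The grouping copies `∑∣j∣≤`, so that coefficients can be
  -- compared term by term.
  Σ± : ℕ → (ℕ → Carrier) → (ℕ → Carrier) → Carrier
  Σ± zero    f⁺ f⁻ = f⁺ 0
  Σ± (suc n) f⁺ f⁻ = Σ± n f⁺ f⁻ + (f⁺ (suc n) + f⁻ (suc n))

  -- Ramanujan's theta function f(a, b) as a product

  module JacobiTripleProduct (a b x : Carrier) (x≈ab : x ≈ a * b) where

    -- With j = k - n this is a^(j(j+1)/2) b^(j(j-1)/2).
    weight : ℕ → ℕ → Carrier
    weight zero    n       = a ^ triangle n * b ^ triangle (suc n)
    weight (suc k) zero    = a ^ triangle (suc (suc k)) * b ^ triangle (suc k)
    weight (suc k) (suc n) = weight k n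

    weight-zeroʳ : ∀ k → weight k 0 ≡ a ^ triangle (suc k) * b ^ triangle k
    weight-zeroʳ zero    = ≡.refl
    weight-zeroʳ (suc k) = ≡.refl

    weight-+ : ∀ n i → weight n (n ℕ.+ i) ≡ weight 0 i
    weight-+ zero    i = ≡.refl
    weight-+ (suc n) i = weight-+ n i

    weight-+′ : ∀ n i → weight (n ℕ.+ i) n ≡ weight i 0
    weight-+′ zero    i = ≡.refl
    weight-+′ (suc n) i = weight-+′ n i

    x^n≈a^n*b^n : ∀ n → x ^ n ≈ a ^ n * b ^ n
    x^n≈a^n*b^n n = trans (^-congˡ n x≈ab) (^-distrib-* a b n)

    weight-sucʳ : ∀ n → weight 0 (suc n) ≈ a ^ n * b ^ suc n * weight 0 n
    weight-sucʳ n = trans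
      (*-cong (^-homo-* a n (triangle n)) (^-homo-* b (suc n) (triangle (suc n))))
      (solve 4 (λ A T B U → A :* T :* (B :* U) := A :* B :* (T :* U)) refl _ _ _ _)

    weight-sucˡ : ∀ k → weight (suc k) 0 ≈ a ^ suc k * b ^ k * weight k 0
    weight-sucˡ k = begin
      weight (suc k) 0
        ≈⟨ *-cong (^-homo-* a (suc k) (triangle (suc k))) (^-homo-* b k (triangle k)) ⟩
      a ^ suc k * a ^ triangle (suc k) * (b ^ k * b ^ triangle k)
        ≈⟨ solve 4 (λ A T B U → A :* T :* (B :* U) := A :* B :* (T :* U)) refl _ _ _ _ ⟩
      a ^ suc k * b ^ k * (a ^ triangle (suc k) * b ^ triangle k)
        ≡⟨ ≡.cong (a ^ suc k * b ^ k *_) (weight-zeroʳ k) ⟨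
      a ^ suc k * b ^ k * weight k 0 ∎

    -- Passing from j = k - n to j + 1 multiplies the weight by a^(j+1) b^j = a x^j, and the
    -- hypothesis says m - l = j. Splitting x^j into x^m and x^l over the two sides keeps all
    -- exponents natural even when j is negative.
    weight-shiftᵃ : ∀ m n k l → m ℕ.+ n ≡ k ℕ.+ l →
      a * x ^ m * weight k n ≈ x ^ l * weight (suc k) n
    weight-shiftᵃ m zero k l e = begin
      a * x ^ m * weight k 0                        ≈⟨ *-congʳ (*-congˡ x^m) ⟩
      a * (a ^ k * b ^ k * x ^ l) * weight k 0      ≈⟨ solve 5 (λ a A B X w → a :* (A :* B :* X) :* w := X :* (a :* A :* B :* w)) refl _ _ _ _ _ ⟩
      x ^ l * (a ^ suc k * b ^ k * weight k 0)      ≈⟨ *-congˡ (weight-sucˡ k) ⟨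
      x ^ l * weight (suc k) 0                      ∎
      where
      x^m : x ^ m ≈ a ^ k * b ^ k * x ^ l
      x^m = begin
        x ^ m                    ≡⟨ ≡.cong (x ^_) (≡.trans (≡.sym (ℕ.+-identityʳ m)) e) ⟩
        x ^ (k ℕ.+ l)            ≈⟨ ^-homo-* x k l ⟩
        x ^ k * x ^ l            ≈⟨ *-congʳ (x^n≈a^n*b^n k) ⟩
        a ^ k * b ^ k * x ^ l    ∎
    weight-shiftᵃ m (suc n) zero l ≡.refl = begin
      a * x ^ m * weight 0 (suc n)                       ≈⟨ *-congˡ (weight-sucʳ n) ⟩
      a * x ^ m * (a ^ n * (b * b ^ n) * weight 0 n)     ≈⟨ solve 6 (λ a X A b B w → a :* X :* (A :* (b :* B) :* w) := X :* (a :* A :* (b :* B)) :* w) refl _ _ _ _ _ _ ⟩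
      x ^ m * (a ^ suc n * b ^ suc n) * weight 0 n       ≈⟨ *-congʳ (*-congˡ (x^n≈a^n*b^n (suc n))) ⟨
      x ^ m * x ^ suc n * weight 0 n                     ≈⟨ *-congʳ (^-homo-* x m (suc n)) ⟨
      x ^ (m ℕ.+ suc n) * weight 0 n                     ∎
    weight-shiftᵃ m (suc n) (suc k) l e =
      weight-shiftᵃ m n k l (ℕ.suc-injective (≡.trans (≡.sym (ℕ.+-suc m n)) e))

    -- The ratio a x^j of consecutive weights, with j = k - n, becomes x^(k+1) after multiplication
    -- by b x^n, because ab = x.
    weight-shiftᵇ : ∀ n k → b * x ^ n * weight (suc k) n ≈ x ^ suc k * weight k n
    weight-shiftᵇ zero k = begin
      b * 1# * weight (suc k) 0                   ≈⟨ *-congˡ (weight-sucˡ k) ⟩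
      b * 1# * (a ^ suc k * b ^ k * weight k 0)   ≈⟨ solve 4 (λ b A B w → b :* con 1 :* (A :* B :* w) := A :* (b :* B) :* w) refl _ _ _ _ ⟩
      a ^ suc k * b ^ suc k * weight k 0          ≈⟨ *-congʳ (x^n≈a^n*b^n (suc k)) ⟨
      x ^ suc k * weight k 0                      ∎
    weight-shiftᵇ (suc n) zero = begin
      b * (x * x ^ n) * weight 0 n                         ≈⟨ *-congʳ (*-congˡ (*-congˡ (x^n≈a^n*b^n n))) ⟩
      b * (x * (a ^ n * b ^ n)) * weight 0 n               ≈⟨ solve 5 (λ b x A B w → b :* (x :* (A :* B)) :* w := x :* con 1 :* (A :* (b :* B) :* w)) refl _ _ _ _ _ ⟩
      x ^ 1 * (a ^ n * b ^ suc n * weight 0 n)             ≈⟨ *-congˡ (weight-sucʳ n) ⟨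
      x ^ 1 * weight 0 (suc n)                             ∎
    weight-shiftᵇ (suc n) (suc k) = begin
      b * (x * x ^ n) * weight (suc k) n   ≈⟨ solve 4 (λ b x y w → b :* (x :* y) :* w := x :* (b :* y :* w)) refl _ _ _ _ ⟩
      x * (b * x ^ n * weight (suc k) n)   ≈⟨ *-congˡ (weight-shiftᵇ n k) ⟩
      x * (x ^ suc k * weight k n)         ≈⟨ *-assoc _ _ _ ⟨
      x ^ suc (suc k) * weight k n         ∎

    term : ℕ → ℕ → ℕ → Carrier
    term n k l = gauss x k l * weight k n

    -- A further a-factor lengthens the sum at its upper end and leaves the centre `n` in place. In
    -- the mirrored Pascal rule one part has k raised by one, and `weight-shiftᵃ` turns its varying
    -- power x^l into the constant multiple a x^m.
    Σ-term-sucᵃ : ∀ m n → Σ₊ (suc (m ℕ.+ n)) (term n) ≈ Σ₊ (m ℕ.+ n) (term n) * (1# + a * x ^ m)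
    Σ-term-sucᵃ m n = begin
      Σ₊ (suc N) (term n)
        ≈⟨ Σ₊-pascal (term n) (λ k l → term n k l) (λ k l → x ^ l * (gauss x k l * weight (suc k) n)) N
             (λ l → refl)
             (λ k → trans (*-congʳ (sym (gauss-zeroʳ x k))) (sym (*-identityˡ _)))
             (λ k l _ → trans (*-congʳ (gauss-pascal x k l))
                (solve 4 (λ X g h w → (X :* g :+ h) :* w := h :* w :+ X :* (g :* w)) refl _ _ _ _)) ⟩
      Σ₊ N (term n) + Σ₊ N (λ k l → x ^ l * (gauss x k l * weight (suc k) n))
        ≈⟨ +-congˡ (Σ₊-cong N (λ k l e → step k l (≡.sym e))) ⟩
      Σ₊ N (term n) + Σ₊ N (λ k l → a * x ^ m * term n k l)
        ≈⟨ +-congˡ (*-Σ₊ N (a * x ^ m) (term n)) ⟨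
      Σ₊ N (term n) + a * x ^ m * Σ₊ N (term n)
        ≈⟨ solve 2 (λ s y → s :+ y :* s := s :* (con 1 :+ y)) refl _ _ ⟩
      Σ₊ N (term n) * (1# + a * x ^ m) ∎
      where
      N = m ℕ.+ n
      step : ∀ k l → N ≡ k ℕ.+ l → x ^ l * (gauss x k l * weight (suc k) n) ≈ a * x ^ m * term n k l
      step k l e = begin
        x ^ l * (gauss x k l * weight (suc k) n)   ≈⟨ solve 3 (λ X g w → X :* (g :* w) := g :* (X :* w)) refl _ _ _ ⟩
        gauss x k l * (x ^ l * weight (suc k) n)   ≈⟨ *-congˡ (weight-shiftᵃ m n k l e) ⟨
        gauss x k l * (a * x ^ m * weight k n)     ≈⟨ solve 3 (λ X g w → g :* (X :* w) := X :* (g :* w)) refl _ _ _ ⟩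
        a * x ^ m * term n k l                     ∎

    -- A further b-factor moves the centre instead: `weight (suc k) (suc n)` is `weight k n`, so old
    -- weights persist under a shifted index and the new one enters at j = -(n + 1).
    Σ-term-sucᵇ : ∀ m n → Σ₊ (suc (m ℕ.+ n)) (term (suc n)) ≈ Σ₊ (m ℕ.+ n) (term n) * (1# + b * x ^ n)
    Σ-term-sucᵇ m n = begin
      Σ₊ (suc N) (term (suc n))
        ≈⟨ Σ₊-pascal (term (suc n)) (λ k l → b * x ^ n * term n k l) (term n) N
             (λ l → trans (*-congˡ (first n)) (solve 3 (λ b X w → con 1 :* (b :* X :* w) := b :* X :* (con 1 :* w)) refl _ _ _))
             (λ k → *-congʳ (sym (gauss-zeroʳ x k)))
             (λ k l _ → step k l) ⟩
      Σ₊ N (λ k l → b * x ^ n * term n k l) + Σ₊ N (term n)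
        ≈⟨ +-congʳ (*-Σ₊ N (b * x ^ n) (term n)) ⟨
      b * x ^ n * Σ₊ N (term n) + Σ₊ N (term n)
        ≈⟨ solve 2 (λ s y → y :* s :+ s := s :* (con 1 :+ y)) refl _ _ ⟩
      Σ₊ N (term n) * (1# + b * x ^ n) ∎
      where
      N = m ℕ.+ n
      first : ∀ n → weight 0 (suc n) ≈ b * x ^ n * weight 0 n
      first n = begin
        weight 0 (suc n)                            ≈⟨ weight-sucʳ n ⟩
        a ^ n * (b * b ^ n) * weight 0 n            ≈⟨ solve 4 (λ b A B w → A :* (b :* B) :* w := b :* (A :* B) :* w) refl _ _ _ _ ⟩
        b * (a ^ n * b ^ n) * weight 0 n            ≈⟨ *-congʳ (*-congˡ (x^n≈a^n*b^n n)) ⟨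
        b * x ^ n * weight 0 n                      ∎
      step : ∀ k l → term (suc n) (suc k) (suc l) ≈ b * x ^ n * term n (suc k) l + term n k (suc l)
      step k l = begin
        (gauss x k (suc l) + x ^ suc k * gauss x (suc k) l) * weight k n
          ≈⟨ solve 4 (λ g X h w → (g :+ X :* h) :* w := h :* (X :* w) :+ g :* w) refl _ _ _ _ ⟩
        gauss x (suc k) l * (x ^ suc k * weight k n) + gauss x k (suc l) * weight k n
          ≈⟨ +-congʳ (*-congˡ (weight-shiftᵇ n k)) ⟨
        gauss x (suc k) l * (b * x ^ n * weight (suc k) n) + gauss x k (suc l) * weight k n
          ≈⟨ +-congʳ (solve 3 (λ X g w → g :* (X :* w) := X :* (g :* w)) refl _ _ _) ⟩
        b * x ^ n * term n (suc k) l + term n k (suc l) ∎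

    finite-tripleProduct : ∀ m n → Σ₊ (m ℕ.+ n) (term n) ≈ poch a x m * poch b x n
    finite-tripleProduct zero    zero    = *-congˡ (*-identityˡ 1#)
    finite-tripleProduct zero    (suc n) = begin
      Σ₊ (suc n) (term (suc n))                       ≈⟨ Σ-term-sucᵇ 0 n ⟩
      Σ₊ n (term n) * (1# + b * x ^ n)                ≈⟨ *-congʳ (finite-tripleProduct 0 n) ⟩
      1# * poch b x n * (1# + b * x ^ n)              ≈⟨ *-assoc _ _ _ ⟩
      1# * (poch b x n * (1# + b * x ^ n))            ∎
    finite-tripleProduct (suc m) n       = begin
      Σ₊ (suc m ℕ.+ n) (term n)                       ≈⟨ Σ-term-sucᵃ m n ⟩
      Σ₊ (m ℕ.+ n) (term n) * (1# + a * x ^ m)        ≈⟨ *-congʳ (finite-tripleProduct m n) ⟩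
      poch a x m * poch b x n * (1# + a * x ^ m)      ≈⟨ solve 3 (λ p q r → p :* q :* r := p :* r :* q) refl _ _ _ ⟩
      poch a x m * (1# + a * x ^ m) * poch b x n      ∎

    weight⁺ weight⁻ : ℕ → Carrier
    weight⁺ i = weight i 0
    weight⁻ i = weight 0 i

    Σ₊-weight : ∀ n → Σ₊ (n ℕ.+ n) (λ k _ → weight k n) ≈ Σ± n weight⁺ weight⁻
    Σ₊-weight zero    = refl
    Σ₊-weight (suc n) = begin
      weight 0 (suc n) + Σ₊ (n ℕ.+ suc n) (λ k _ → weight k n)
        ≡⟨ ≡.cong (λ N → weight 0 (suc n) + Σ₊ N (λ k _ → weight k n)) (ℕ.+-suc n n) ⟩
      weight 0 (suc n) + Σ₊ (suc (n ℕ.+ n)) (λ k _ → weight k n)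
        ≈⟨ +-congˡ (Σ₊-peelʳ (n ℕ.+ n) (λ k _ → weight k n)) ⟩
      weight 0 (suc n) + (Σ₊ (n ℕ.+ n) (λ k _ → weight k n) + weight (suc (n ℕ.+ n)) n)
        ≈⟨ +-congˡ (+-cong (Σ₊-weight n) (reflexive (≡.trans (≡.cong (λ k → weight k n) (≡.sym (ℕ.+-suc n n))) (weight-+′ n (suc n))))) ⟩
      weight 0 (suc n) + (Σ± n weight⁺ weight⁻ + weight⁺ (suc n))
        ≈⟨ solve 3 (λ a b c → a :+ (b :+ c) := b :+ (c :+ a)) refl _ _ _ ⟩
      Σ± (suc n) weight⁺ weight⁻ ∎

    -- Isolates the power of x inside a weight; this is the monomial against which the far factors
    -- of (x; x) become trivial.
    weight⁻-factor : ∀ i → weight⁻ i ≈ x ^ triangle i * b ^ i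
    weight⁻-factor i = begin
      a ^ triangle i * b ^ (i ℕ.+ triangle i)            ≈⟨ *-congˡ (^-homo-* b i (triangle i)) ⟩
      a ^ triangle i * (b ^ i * b ^ triangle i)          ≈⟨ solve 3 (λ A B C → A :* (B :* C) := A :* C :* B) refl _ _ _ ⟩
      a ^ triangle i * b ^ triangle i * b ^ i            ≈⟨ *-congʳ (x^n≈a^n*b^n (triangle i)) ⟨
      x ^ triangle i * b ^ i                             ∎

    weight⁺-factor : ∀ i → weight⁺ i ≈ x ^ triangle i * a ^ i
    weight⁺-factor i = begin
      weight i 0                                         ≡⟨ weight-zeroʳ i ⟩
      a ^ (i ℕ.+ triangle i) * b ^ triangle i            ≈⟨ *-congʳ (^-homo-* a i (triangle i)) ⟩
      a ^ i * a ^ triangle i * b ^ triangle i            ≈⟨ solve 3 (λ A B C → A :* B :* C := B :* C :* A) refl _ _ _ ⟩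
      a ^ triangle i * b ^ triangle i * a ^ i            ≈⟨ *-congʳ (x^n≈a^n*b^n (triangle i)) ⟨
      x ^ triangle i * a ^ i                             ∎

    -- Here k + i is the nilpotency exponent. The factors of (x; x) after the k-th are absorbed by
    -- x^(triangle i), and the first k of them turn the binomial into (x^(l+1); x)_k with l = k +
    -- 2i, all of whose factors are 1 because l + 1 exceeds k + i.
    gauss-absorb : ∀ k i → x ^ (k ℕ.+ i) ≈ 0# →
      x ^ triangle i * (gauss x k (k ℕ.+ (i ℕ.+ i)) * poch (- x) x (k ℕ.+ i)) ≈ x ^ triangle i
    gauss-absorb k i h = begin
      t * (g * poch (- x) x (k ℕ.+ i))       ≈⟨ solve 3 (λ t g p → t :* (g :* p) := g :* (t :* p)) refl _ _ _ ⟩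
      g * (t * poch (- x) x (k ℕ.+ i))       ≈⟨ *-congˡ (poch-absorb t (- x) x k i vanish) ⟩
      g * (t * poch (- x) x k)               ≈⟨ solve 3 (λ t g p → g :* (t :* p) := t :* (g :* p)) refl _ _ _ ⟩
      t * (g * poch (- x) x k)               ≈⟨ *-congˡ (trans (gauss-poch x k l) (sym (*-identityˡ _))) ⟩
      t * (1# * poch (- x ^ suc l) x k)      ≈⟨ *-congˡ (poch-absorb 1# (- x ^ suc l) x 0 k
                                                  (trans (*-identityˡ _) (trans (*-identityʳ _) (trans (-‿cong big) -0#≈0#)))) ⟩
      t * (1# * 1#)                          ≈⟨ solve 1 (λ t → t :* (con 1 :* con 1) := t) refl t ⟩
      t                                      ∎
      where
      t = x ^ triangle i
      l = k ℕ.+ (i ℕ.+ i)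
      g = gauss x k l
      -- Equality holds at i = 1 and i = 2: there the first factor after the k-th only just reaches
      -- the vanishing power.
      i≤1+triangle : ∀ i → i ℕ.≤ suc (triangle i)
      i≤1+triangle zero          = ℕ.z≤n
      i≤1+triangle (suc zero)    = ℕ.s≤s ℕ.z≤n
      i≤1+triangle (suc (suc i)) = ℕ.s≤s (ℕ.s≤s (ℕ.m≤m+n i (triangle (suc i))))
      ≥⇒≈0 : ∀ {m} → k ℕ.+ i ℕ.≤ m → x ^ m ≈ 0#
      ≥⇒≈0 {m} k+i≤m = trans (^-congʳ x (≡.sym (ℕ.m+[n∸m]≡n k+i≤m)))
                             (x^m≈0⇒x^[m+d]≈0 x (k ℕ.+ i) _ h)
      big : x ^ suc l ≈ 0#
      big = ≥⇒≈0 (ℕ.m≤n⇒m≤1+n (ℕ.+-monoʳ-≤ k (ℕ.m≤m+n i i)))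
      vanish : t * (- x * x ^ k) ≈ 0#
      vanish = begin
        t * (- x * x ^ k)               ≈⟨ *-congˡ (-‿distribˡ-* x (x ^ k)) ⟨
        t * - x ^ suc k                 ≈⟨ -‿distribʳ-* t _ ⟨
        - (t * x ^ suc k)               ≈⟨ -‿cong (^-homo-* x (triangle i) (suc k)) ⟨
        - x ^ (triangle i ℕ.+ suc k)    ≈⟨ -‿cong (≥⇒≈0 k+i≤) ⟩
        - 0#                            ≈⟨ -0#≈0# ⟩
        0#                              ∎
        where
        k+i≤ : k ℕ.+ i ℕ.≤ triangle i ℕ.+ suc k
        k+i≤ = ℕ.≤-trans (ℕ.+-monoʳ-≤ k (i≤1+triangle i))
          (ℕ.≤-reflexive (≡.trans (ℕ.+-comm k _) (≡.sym (ℕ.+-suc (triangle i) k))))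

    term-absorb-≤ : ∀ k i → x ^ (k ℕ.+ i) ≈ 0# →
      poch (- x) x (k ℕ.+ i) * term (k ℕ.+ i) k (k ℕ.+ (i ℕ.+ i)) ≈ weight k (k ℕ.+ i)
    term-absorb-≤ k i h = begin
      π * (g * weight k (k ℕ.+ i))          ≈⟨ *-congˡ (*-congˡ w≈) ⟩
      π * (g * (x ^ triangle i * b ^ i))    ≈⟨ solve 4 (λ p g t b → p :* (g :* (t :* b)) := t :* (g :* p) :* b) refl _ _ _ _ ⟩
      x ^ triangle i * (g * π) * b ^ i      ≈⟨ *-congʳ (gauss-absorb k i h) ⟩
      x ^ triangle i * b ^ i                ≈⟨ w≈ ⟨
      weight k (k ℕ.+ i)                    ∎
      where
      π = poch (- x) x (k ℕ.+ i)
      g = gauss x k (k ℕ.+ (i ℕ.+ i))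
      w≈ : weight k (k ℕ.+ i) ≈ x ^ triangle i * b ^ i
      w≈ = trans (reflexive (weight-+ k i)) (weight⁻-factor i)

    -- The half with j = i ≥ 0; symmetry of `gauss` makes the smaller index l play the role that k
    -- has for j ≤ 0.
    term-absorb-≥ : ∀ l i → x ^ (l ℕ.+ i) ≈ 0# →
      poch (- x) x (l ℕ.+ i) * term (l ℕ.+ i) (l ℕ.+ i ℕ.+ i) l ≈ weight (l ℕ.+ i ℕ.+ i) (l ℕ.+ i)
    term-absorb-≥ l i h = begin
      π * (gauss x (l ℕ.+ i ℕ.+ i) l * weight (l ℕ.+ i ℕ.+ i) (l ℕ.+ i))
                                            ≈⟨ *-congˡ (*-cong g≈ w≈) ⟩
      π * (g * (x ^ triangle i * a ^ i))    ≈⟨ solve 4 (λ p g t b → p :* (g :* (t :* b)) := t :* (g :* p) :* b) refl _ _ _ _ ⟩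
      x ^ triangle i * (g * π) * a ^ i      ≈⟨ *-congʳ (gauss-absorb l i h) ⟩
      x ^ triangle i * a ^ i                ≈⟨ w≈ ⟨
      weight (l ℕ.+ i ℕ.+ i) (l ℕ.+ i)      ∎
      where
      π = poch (- x) x (l ℕ.+ i)
      g = gauss x l (l ℕ.+ (i ℕ.+ i))
      g≈ : gauss x (l ℕ.+ i ℕ.+ i) l ≈ g
      g≈ = trans (gauss-comm x _ l) (reflexive (≡.cong (gauss x l) (ℕ.+-assoc l i i)))
      w≈ : weight (l ℕ.+ i ℕ.+ i) (l ℕ.+ i) ≈ x ^ triangle i * a ^ i
      w≈ = trans (reflexive (weight-+′ (l ℕ.+ i) i)) (weight⁺-factor i)

    private
      k+i+[k+i] : ∀ k i → k ℕ.+ i ℕ.+ (k ℕ.+ i) ≡ k ℕ.+ (k ℕ.+ (i ℕ.+ i))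
      k+i+[k+i] = ℕ-Solver.solve-∀

      n+i+l : ∀ n i l → n ℕ.+ i ℕ.+ l ≡ n ℕ.+ (l ℕ.+ i)
      n+i+l = ℕ-Solver.solve-∀

    term-absorb : ∀ n k l → k ℕ.+ l ≡ n ℕ.+ n → x ^ n ≈ 0# →
      poch (- x) x n * term n k l ≈ weight k n
    term-absorb n k l e h with ℕ.≤-total k n
    ... | inj₁ k≤n
      with i , ≡.refl ← ℕ.m≤n⇒∃[o]m+o≡n k≤n
      with ≡.refl ← ℕ.+-cancelˡ-≡ k _ _ (≡.trans e (k+i+[k+i] k i))
      = term-absorb-≤ k i h
    ... | inj₂ n≤k
      with i , ≡.refl ← ℕ.m≤n⇒∃[o]m+o≡n n≤k
      with ≡.refl ← ℕ.+-cancelˡ-≡ n _ _ (≡.trans (≡.sym e) (n+i+l n i l))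
      = term-absorb-≥ l i h

    tripleProduct : ∀ n → x ^ n ≈ 0# →
      poch (- x) x n * (poch a x n * poch b x n) ≈ Σ± n weight⁺ weight⁻
    tripleProduct n h = begin
      poch (- x) x n * (poch a x n * poch b x n)         ≈⟨ *-congˡ (finite-tripleProduct n n) ⟨
      poch (- x) x n * Σ₊ (n ℕ.+ n) (term n)             ≈⟨ *-Σ₊ (n ℕ.+ n) _ (term n) ⟩
      Σ₊ (n ℕ.+ n) (λ k l → poch (- x) x n * term n k l) ≈⟨ Σ₊-cong (n ℕ.+ n) (λ k l e → term-absorb n k l e h) ⟩
      Σ₊ (n ℕ.+ n) (λ k _ → weight k n)                  ≈⟨ Σ₊-weight n ⟩
      Σ± n weight⁺ weight⁻                               ∎

  -- The two theta functions and the identity between their products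

  module _ (q : Carrier) (n : ℕ) (q^n≈0 : q ^ n ≈ 0#) where

    private
      x = q * (q * q)
      module Θ = JacobiTripleProduct (- x) (- x) (x * x) (sym ([-x][-y]≈xy x x))
      module Φ = JacobiTripleProduct (q * q) q x (sym (*-assoc q q q))
      A = poch (- x) (x * x) n
      B = poch (- (x * x)) (x * x) n
      C = poch (- x) x n
      D = poch x x n
      E = poch q (q * q) n
      G = poch (q * q) (q * q) n
      K = poch (- (q * q)) (q * q) n
      L = poch (- (q * q * (q * q))) (q * q * (q * q)) n
      U = poch q x n
      V = poch (q * q) x n

      [qy]^n≈0 : ∀ y → (q * y) ^ n ≈ 0#
      [qy]^n≈0 y = trans (^-distrib-* q y n) (trans (*-congʳ q^n≈0) (zeroˡ _))

      -- Sorting a product by residues modulo 2 or 3 involves 2n or 3n factors; nilpotency brings it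
      -- back to the common length n.
      poch-stable-* : ∀ c y m → y ^ n ≈ 0# → poch c y (n ℕ.* suc m) ≈ poch c y n
      poch-stable-* c y m h = trans
        (reflexive (≡.cong (poch c y) (ℕ.*-suc n m))) (poch-stable c y n (n ℕ.* m) h)

      A*B≈C : A * B ≈ C
      A*B≈C = begin
        A * B                                         ≈⟨ *-congˡ (poch-cong (-‿distribˡ-* x x) refl n) ⟩
        A * poch (- x * x) (x * x) n                  ≈⟨ poch-split₂ (- x) x n ⟨
        poch (- x) x (n ℕ.* 2)                        ≈⟨ poch-stable-* (- x) x 1 ([qy]^n≈0 _) ⟩
        C                                             ∎

      -- Both sides are (-q; q), its exponents sorted by residue modulo 2 on the left and modulo 3
      -- on the right.
      E*G≈U*V*D : E * G ≈ U * V * D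
      E*G≈U*V*D = begin
        E * G                     ≈⟨ poch-split₂ q q n ⟨
        poch q q (n ℕ.* 2)        ≈⟨ poch-stable-* q q 1 q^n≈0 ⟩
        poch q q n                ≈⟨ poch-stable-* q q 2 q^n≈0 ⟨
        poch q q (n ℕ.* 3)        ≈⟨ poch-split₃ q q n ⟩
        U * V * D                 ∎

    -- The hypotheses encode f = (-q; q²)/(q²; q²) and g = 1/(q⁴; q⁴).
    series-identity : ∀ f g → f * K ≈ E → g * L ≈ 1# →
      f * Σ± n Θ.weight⁺ Θ.weight⁻ ≈ g * Σ± n Φ.weight⁺ Φ.weight⁻
    series-identity f g fK≈E gL≈1 = begin
      f * Σ± n Θ.weight⁺ Θ.weight⁻     ≈⟨ *-congˡ (Θ.tripleProduct n [x*x]^n≈0) ⟨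
      f * (B * (A * A))                ≈⟨ *-identityˡ _ ⟨
      -- Inserting 1 = g L pays off because L = K G: `K` clears the denominator of `f`, and `G`
      -- completes the resulting `E` to (-q; q).
      1# * (f * (B * (A * A)))         ≈⟨ *-congʳ gL≈1 ⟨
      g * L * (f * (B * (A * A)))      ≈⟨ *-congʳ (*-congˡ (poch-negˡ (q * q) n)) ⟨
      g * (K * G) * (f * (B * (A * A)))
        ≈⟨ solve 6 (λ g K G f B A → g :* (K :* G) :* (f :* (B :* (A :* A))) := g :* (f :* K :* G :* (A :* (A :* B)))) refl g K G f B A ⟩
      g * (f * K * G * (A * (A * B)))  ≈⟨ *-congˡ (*-cong (trans (*-congʳ fK≈E) E*G≈U*V*D) (*-congˡ A*B≈C)) ⟩
      g * (U * V * D * (A * C))        ≈⟨ solve 6 (λ g U V D A C → g :* (U :* V :* D :* (A :* C)) := g :* (A :* (C :* D) :* (V :* U))) refl g U V D A C ⟩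
      g * (A * (C * D) * (V * U))      ≈⟨ *-congˡ (*-congʳ (trans (*-congˡ (poch-negˡ x n)) A*B≈C)) ⟩
      g * (C * (V * U))                ≈⟨ *-congˡ (Φ.tripleProduct n ([qy]^n≈0 _)) ⟩
      g * Σ± n Φ.weight⁺ Φ.weight⁻     ∎
      where
      [x*x]^n≈0 : (x * x) ^ n ≈ 0#
      [x*x]^n≈0 = trans (^-distrib-* x x n) (trans (*-congʳ ([qy]^n≈0 _)) (zeroˡ _))

    Θ-weight⁺ : ∀ i → Θ.weight⁺ i ≈ (- 1#) ^ i * q ^ (3 ℕ.* (i ℕ.* i))
    Θ-weight⁺ i = begin
      Θ.weight⁺ i                                        ≈⟨ Θ.weight⁺-factor i ⟩
      (x * x) ^ t * (- x) ^ i                            ≈⟨ *-cong (^-distrib-* x x t) (^-congˡ i (sym (-1*x≈-x x))) ⟩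
      x ^ t * x ^ t * (- 1# * x) ^ i                     ≈⟨ *-congˡ (^-distrib-* (- 1#) x i) ⟩
      x ^ t * x ^ t * ((- 1#) ^ i * x ^ i)               ≈⟨ solve 3 (λ t e x → t :* t :* (e :* x) := e :* (x :* (t :* t))) refl _ _ _ ⟩
      (- 1#) ^ i * (x ^ i * (x ^ t * x ^ t))             ≈⟨ *-congˡ (trans (^-homo-* x i (t ℕ.+ t)) (*-congˡ (^-homo-* x t t))) ⟨
      (- 1#) ^ i * x ^ (i ℕ.+ (t ℕ.+ t))                 ≈⟨ *-congˡ (^-cong q³ (i+2triangle i)) ⟩
      (- 1#) ^ i * (q ^ 3) ^ (i ℕ.* i)                   ≈⟨ *-congˡ (^-assocʳ q 3 (i ℕ.* i)) ⟩
      (- 1#) ^ i * q ^ (3 ℕ.* (i ℕ.* i))                 ∎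
      where
      t = triangle i
      q³ : x ≈ q ^ 3
      q³ = *-congˡ (*-congˡ (sym (*-identityʳ q)))

    Θ-weight⁻ : ∀ i → Θ.weight⁻ i ≈ (- 1#) ^ i * q ^ (3 ℕ.* (i ℕ.* i))
    Θ-weight⁻ i = begin
      (- x) ^ triangle i * (- x) ^ triangle (suc i)      ≈⟨ *-comm _ _ ⟩
      (- x) ^ triangle (suc i) * (- x) ^ triangle i      ≡⟨ Θ.weight-zeroʳ i ⟨
      Θ.weight⁺ i                                        ≈⟨ Θ-weight⁺ i ⟩
      (- 1#) ^ i * q ^ (3 ℕ.* (i ℕ.* i))                 ∎

    private
      [q*q]^m*q^k : ∀ m k → (q * q) ^ m * q ^ k ≈ q ^ (m ℕ.+ m ℕ.+ k)
      [q*q]^m*q^k m k = begin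
        (q * q) ^ m * q ^ k        ≈⟨ *-congʳ (^-distrib-* q q m) ⟩
        q ^ m * q ^ m * q ^ k      ≈⟨ *-congʳ (^-homo-* q m m) ⟨
        q ^ (m ℕ.+ m) * q ^ k      ≈⟨ ^-homo-* q (m ℕ.+ m) k ⟨
        q ^ (m ℕ.+ m ℕ.+ k)        ∎

    Φ-weight⁺ : ∀ i → Φ.weight⁺ i ≈ q ^ (triangle (suc i) ℕ.+ triangle (suc i) ℕ.+ triangle i)
    Φ-weight⁺ i = trans (reflexive (Φ.weight-zeroʳ i)) ([q*q]^m*q^k (triangle (suc i)) (triangle i))

    Φ-weight⁻ : ∀ i → Φ.weight⁻ i ≈ q ^ (triangle i ℕ.+ triangle i ℕ.+ triangle (suc i))
    Φ-weight⁻ i = [q*q]^m*q^k (triangle i) (triangle (suc i))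

-- Formal power series

open ≡ using (refl; sym; trans; cong; cong₂; subst)

Series : Set
Series = ℕ → ℤ

infixl 6 _⊕_
infixl 7 _⊛_

_⊕_ : Series → Series → Series
(f ⊕ g) n = f n ℤ.+ g n

⊖_ : Series → Series
(⊖ f) n = ℤ.- f n

𝟎 𝟏 X : Series
𝟎 n = 0ℤ
𝟏 zero    = 1ℤ
𝟏 (suc n) = 0ℤ
X zero    = 0ℤ
X (suc n) = 𝟏 n

-- Cauchy product: (f₀ + X f′) g = f₀ g + X (f′ g)
_⊛_ : Series → Series → Series
(f ⊛ g) zero    = f 0 ℤ.* g 0
(f ⊛ g) (suc n) = f 0 ℤ.* g (suc n) ℤ.+ (f ∘ suc ⊛ g) n

⊛-cong-≤ : ∀ {f f′ g g′} n → (∀ k → k ≤ n → f k ≡ f′ k) → (∀ k → k ≤ n → g k ≡ g′ k) →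
  (f ⊛ g) n ≡ (f′ ⊛ g′) n
⊛-cong-≤ zero    p q = cong₂ ℤ._*_ (p 0 z≤n) (q 0 z≤n)
⊛-cong-≤ (suc n) p q = cong₂ ℤ._+_ (cong₂ ℤ._*_ (p 0 z≤n) (q (suc n) ℕ.≤-refl))
  (⊛-cong-≤ n (λ k k≤n → p (suc k) (s≤s k≤n)) (λ k k≤n → q k (ℕ.m≤n⇒m≤1+n k≤n)))

⊛-congʳ : ∀ {f f′ g} → f ≗ f′ → f ⊛ g ≗ f′ ⊛ g
⊛-congʳ p n = ⊛-cong-≤ n (λ k _ → p k) (λ _ _ → refl)

-- Peels the second factor where the definition peels the first; comparing the two recursions gives
-- commutativity.
⊛-sucʳ : ∀ f g n → (f ⊛ g) (suc n) ≡ f (suc n) ℤ.* g 0 ℤ.+ (f ⊛ g ∘ suc) n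
⊛-sucʳ f g zero    = ℤ.+-comm (f 0 ℤ.* g 1) (f 1 ℤ.* g 0)
⊛-sucʳ f g (suc n) = trans (cong (λ z → f 0 ℤ.* g (2 ℕ.+ n) ℤ.+ z) (⊛-sucʳ (f ∘ suc) g n))
  (swap (f 0 ℤ.* g (2 ℕ.+ n)) (f (2 ℕ.+ n) ℤ.* g 0) _)
  where
  swap : ∀ a b c → a ℤ.+ (b ℤ.+ c) ≡ b ℤ.+ (a ℤ.+ c)
  swap = ℤ-Solver.solve-∀

⊛-comm : ∀ f g → f ⊛ g ≗ g ⊛ f
⊛-comm f g zero    = ℤ.*-comm (f 0) (g 0)
⊛-comm f g (suc n) = trans (cong₂ ℤ._+_ (ℤ.*-comm (f 0) (g (suc n))) (⊛-comm (f ∘ suc) g n))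
  (sym (⊛-sucʳ g f n))

⊛-distribʳ : ∀ h f g → (f ⊕ g) ⊛ h ≗ f ⊛ h ⊕ g ⊛ h
⊛-distribʳ h f g zero    = ℤ.*-distribʳ-+ (h 0) (f 0) (g 0)
⊛-distribʳ h f g (suc n) = trans
  (cong (λ z → (f 0 ℤ.+ g 0) ℤ.* h (suc n) ℤ.+ z) (⊛-distribʳ h (f ∘ suc) (g ∘ suc) n))
  (lemma (f 0) (g 0) (h (suc n)) _ _)
  where
  lemma : ∀ a b c x y → (a ℤ.+ b) ℤ.* c ℤ.+ (x ℤ.+ y) ≡ a ℤ.* c ℤ.+ x ℤ.+ (b ℤ.* c ℤ.+ y)
  lemma = ℤ-Solver.solve-∀

⊛-distribˡ : ∀ h f g → h ⊛ (f ⊕ g) ≗ h ⊛ f ⊕ h ⊛ g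
⊛-distribˡ h f g n = trans (⊛-comm h (f ⊕ g) n)
  (trans (⊛-distribʳ h f g n) (cong₂ ℤ._+_ (⊛-comm f h n) (⊛-comm g h n)))

⊛-scale : ∀ c f g n → ((λ k → c ℤ.* f k) ⊛ g) n ≡ c ℤ.* (f ⊛ g) n
⊛-scale c f g zero    = ℤ.*-assoc c (f 0) (g 0)
⊛-scale c f g (suc n) = trans
  (cong (λ z → c ℤ.* f 0 ℤ.* g (suc n) ℤ.+ z) (⊛-scale c (f ∘ suc) g n))
  (lemma c (f 0) (g (suc n)) _)
  where
  lemma : ∀ c a b x → c ℤ.* a ℤ.* b ℤ.+ c ℤ.* x ≡ c ℤ.* (a ℤ.* b ℤ.+ x)
  lemma = ℤ-Solver.solve-∀

⊛-assoc : ∀ f g h → (f ⊛ g) ⊛ h ≗ f ⊛ (g ⊛ h)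
⊛-assoc f g h zero    = ℤ.*-assoc (f 0) (g 0) (h 0)
⊛-assoc f g h (suc n) = trans
  (cong (λ z → f 0 ℤ.* g 0 ℤ.* h (suc n) ℤ.+ z)
    -- The tail of `f ⊛ g` is by definition f₀ times the tail of g, plus the tail of f times g; the
    -- two parts are treated separately.
    (trans (⊛-distribʳ h (λ k → f 0 ℤ.* g (suc k)) (f ∘ suc ⊛ g) n)
      (cong₂ ℤ._+_ (⊛-scale (f 0) (g ∘ suc) h n) (⊛-assoc (f ∘ suc) g h n))))
  (lemma (f 0) (g 0) (h (suc n)) _ _)
  where
  lemma : ∀ a b c x y → a ℤ.* b ℤ.* c ℤ.+ (a ℤ.* x ℤ.+ y) ≡ a ℤ.* (b ℤ.* c ℤ.+ x) ℤ.+ y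
  lemma = ℤ-Solver.solve-∀

⊛-zeroˡ : ∀ f → 𝟎 ⊛ f ≗ 𝟎
⊛-zeroˡ f zero    = refl
⊛-zeroˡ f (suc n) = trans (ℤ.+-identityˡ _) (⊛-zeroˡ f n)

⊛-identityˡ : ∀ f → 𝟏 ⊛ f ≗ f
⊛-identityˡ f zero    = ℤ.*-identityˡ (f 0)
⊛-identityˡ f (suc n) = trans (cong₂ ℤ._+_ (ℤ.*-identityˡ (f (suc n))) (⊛-zeroˡ f n))
  (ℤ.+-identityʳ (f (suc n)))

⊛-identityʳ : ∀ f → f ⊛ 𝟏 ≗ f
⊛-identityʳ f n = trans (⊛-comm f 𝟏 n) (⊛-identityˡ f n)

X⊛-suc : ∀ f n → (X ⊛ f) (suc n) ≡ f n
X⊛-suc f n = trans (ℤ.+-identityˡ _) (trans (⊛-congʳ {X ∘ suc} {𝟏} (λ _ → refl) n) (⊛-identityˡ f n))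

-- ℤ⟦X⟧ / (X ^ suc N), on representatives.
truncated : ℕ → CommutativeRing 0ℓ 0ℓ
truncated N = record
  { Carrier = Series
  ; _≈_     = λ f g → ∀ k → k ≤ N → f k ≡ g k
  ; _+_     = _⊕_
  ; _*_     = _⊛_
  ; -_      = ⊖_
  ; 0#      = 𝟎
  ; 1#      = 𝟏
  ; isCommutativeRing = record
    { isRing = record
      { +-isAbelianGroup = record
        { isGroup = record
          { isMonoid = record
            { isSemigroup = record
              { isMagma = record
                { isEquivalence = record
                  { refl  = λ _ _ → refl
                  ; sym   = λ p k k≤N → sym (p k k≤N)
                  ; trans = λ p q k k≤N → trans (p k k≤N) (q k k≤N)
                  }
                ; ∙-cong = λ p q k k≤N → cong₂ ℤ._+_ (p k k≤N) (q k k≤N)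
                }
              ; assoc = λ f g h k _ → ℤ.+-assoc (f k) (g k) (h k)
              }
            ; identity = (λ f k _ → ℤ.+-identityˡ (f k)) , (λ f k _ → ℤ.+-identityʳ (f k))
            }
          ; inverse = (λ f k _ → ℤ.+-inverseˡ (f k)) , (λ f k _ → ℤ.+-inverseʳ (f k))
          ; ⁻¹-cong = λ p k k≤N → cong ℤ.-_ (p k k≤N)
          }
        ; comm = λ f g k _ → ℤ.+-comm (f k) (g k)
        }
      ; *-cong = λ p q k k≤N → ⊛-cong-≤ k
          (λ i i≤k → p i (ℕ.≤-trans i≤k k≤N)) (λ i i≤k → q i (ℕ.≤-trans i≤k k≤N))
      ; *-assoc = λ f g h k _ → ⊛-assoc f g h k
      ; *-identity = (λ f k _ → ⊛-identityˡ f k) , (λ f k _ → ⊛-identityʳ f k)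
      ; distrib = (λ h f g k _ → ⊛-distribˡ h f g k) , (λ h f g k _ → ⊛-distribʳ h f g k)
      }
    ; *-comm = λ f g k _ → ⊛-comm f g k
    }
  }

-- Multiplication by a power of X and substitution of X⁴ for X

shift : ℕ → Series → Series
shift zero    f n       = f n
shift (suc e) f zero    = 0ℤ
shift (suc e) f (suc n) = shift e f n

shift-< : ∀ {e n} f → n ℕ.< e → shift e f n ≡ 0ℤ
shift-< {suc e} {zero}  f _         = refl
shift-< {suc e} {suc n} f (s≤s n<e) = shift-< f n<e

shift-+ : ∀ e f n → shift e f (e ℕ.+ n) ≡ f n
shift-+ zero    f n = refl
shift-+ (suc e) f n = shift-+ e f n

-- The series f(X⁴). Recursion in steps of four reaches the coefficient at n/4 without dividing.
dilate : Series → Series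
dilate f 0                         = f 0
dilate f 1                         = 0ℤ
dilate f 2                         = 0ℤ
dilate f 3                         = 0ℤ
dilate f (suc (suc (suc (suc n)))) = dilate (f ∘ suc) n

dilate-cong-≤ : ∀ {f g} n → (∀ k → k ≤ n → f k ≡ g k) → dilate f n ≡ dilate g n
dilate-cong-≤ 0 p = p 0 z≤n
dilate-cong-≤ 1 p = refl
dilate-cong-≤ 2 p = refl
dilate-cong-≤ 3 p = refl
dilate-cong-≤ (suc (suc (suc (suc n)))) p = dilate-cong-≤ n
  (λ k k≤n → p (suc k) (s≤s (ℕ.m≤n⇒m≤1+n (ℕ.m≤n⇒m≤1+n (ℕ.m≤n⇒m≤1+n k≤n)))))

dilate-⊕ : ∀ f g → dilate (f ⊕ g) ≗ dilate f ⊕ dilate g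
dilate-⊕ f g 0 = refl
dilate-⊕ f g 1 = refl
dilate-⊕ f g 2 = refl
dilate-⊕ f g 3 = refl
dilate-⊕ f g (suc (suc (suc (suc n)))) = dilate-⊕ (f ∘ suc) (g ∘ suc) n

dilate-shift : ∀ e f → dilate (shift e f) ≗ shift (e ℕ.* 4) (dilate f)
dilate-shift zero    f n = refl
dilate-shift (suc e) f 0 = refl
dilate-shift (suc e) f 1 = refl
dilate-shift (suc e) f 2 = refl
dilate-shift (suc e) f 3 = refl
dilate-shift (suc e) f (suc (suc (suc (suc n)))) = dilate-shift e f n

dilate-𝟏 : dilate 𝟏 ≗ 𝟏
dilate-𝟏 0 = refl
dilate-𝟏 1 = refl
dilate-𝟏 2 = refl
dilate-𝟏 3 = refl
dilate-𝟏 (suc (suc (suc (suc n)))) = dilate-𝟎 n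
  where
  dilate-𝟎 : dilate 𝟎 ≗ 𝟎
  dilate-𝟎 0 = refl
  dilate-𝟎 1 = refl
  dilate-𝟎 2 = refl
  dilate-𝟎 3 = refl
  dilate-𝟎 (suc (suc (suc (suc n)))) = dilate-𝟎 n

dilate-*4 : ∀ f m → dilate f (m ℕ.* 4) ≡ f m
dilate-*4 f zero    = refl
dilate-*4 f (suc m) = dilate-*4 (f ∘ suc) m

dilate-support : ∀ f n → (∃[ m ] n ≡ m ℕ.* 4) ⊎ dilate f n ≡ 0ℤ
dilate-support f 0 = inj₁ (0 , refl)
dilate-support f 1 = inj₂ refl
dilate-support f 2 = inj₂ refl
dilate-support f 3 = inj₂ refl
dilate-support f (suc (suc (suc (suc n)))) =
  Sum.map₁ (λ (m , n≡) → suc m , cong (4 ℕ.+_) n≡) (dilate-support (f ∘ suc) n)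

-- Partition counts

unique⇒length-≡ : ∀ {A : Set} {xs ys : List A} → Unique xs → Unique ys →
  (∀ {z} → z ∈ xs → z ∈ ys) → (∀ {z} → z ∈ ys → z ∈ xs) → length xs ≡ length ys
unique⇒length-≡ u v to from = ↭-length (∼bag⇒↭ (unique∧set⇒bag u v (mk⇔ to from)))

parts≤sum : ∀ xs → All (_≤ sum xs) xs
parts≤sum []       = []
parts≤sum (x ∷ xs) = ℕ.m≤m+n x _ ∷ All.map (λ y≤ → ℕ.≤-trans y≤ (ℕ.m≤n+m _ x)) (parts≤sum xs)

-- One family of counts serves both functions: parts in `D` must not repeat, so the odd numbers as
-- `D` give pod and the empty set gives p.
module DistinctOn {D : ℕ → Set} (D? : Decidable D) where

  IsDPartition : ℕ → List ℕ → Set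
  IsDPartition n xs = IsPartition n xs × Unique (filter D? xs)

  IsBounded : ℕ → ℕ → List ℕ → Set
  IsBounded m n xs = All (_≤ m) xs × IsDPartition n xs

  isBounded? : ∀ m n → Decidable (IsBounded m n)
  isBounded? m n xs = all? (_≤? m) xs ×-dec isPartition? n xs ×-dec unique? (filter D? xs)

  bounded : ℕ → ℕ → List (List ℕ)
  bounded m n = filter (isBounded? m n) (lists n n)

  bounded-unique : ∀ m n → Unique (bounded m n)
  bounded-unique m n = filter⁺ (isBounded? m n) (lists-unique n n)

  ∈-bounded⁺ : ∀ {m n xs} → IsBounded m n xs → xs ∈ bounded m n
  ∈-bounded⁺ {m} {n} v@(_ , q , _) = ∈-filter⁺ (isBounded? m n) (partition∈lists q) v

  ∈-bounded⁻ : ∀ {m n xs} → xs ∈ bounded m n → IsBounded m n xs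
  ∈-bounded⁻ {m} {n} xs∈ = proj₂ (∈-filter⁻ (isBounded? m n) {xs = lists n n} xs∈)

  count : ℕ → Series
  count m n = + length (bounded m n)

  -- No part exceeds the sum, so the bound m excludes nothing once n ≤ m. This lets a finite product
  -- reproduce the true coefficients up to the truncation order.
  count-complete : ∀ {m n xss} → n ≤ m → Unique xss →
    (∀ {xs} → xs ∈ xss → IsDPartition n xs) → (∀ {xs} → IsDPartition n xs → xs ∈ xss) →
    count m n ≡ + length xss
  count-complete {m} {n} n≤m u to from = cong +_ (unique⇒length-≡ (bounded-unique m n) u
    (λ xs∈ → from (proj₂ (∈-bounded⁻ {m} xs∈)))
    (λ xs∈ → ∈-bounded⁺ (bound (to xs∈) , to xs∈)))
    where
    bound : ∀ {xs} → IsDPartition n xs → All (_≤ m) xs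
    bound {xs} ((_ , _ , refl) , _) = All.map (λ x≤ → ℕ.≤-trans x≤ n≤m) (parts≤sum xs)

  count-zero : count 0 ≗ 𝟏
  count-zero zero    = cong +_ (unique⇒length-≡ {ys = [] ∷ []} (bounded-unique 0 0) ([] ∷ []) to from)
    where
    to : ∀ {xs} → xs ∈ bounded 0 0 → xs ∈ [] ∷ []
    to {xs} xs∈ with ∈-bounded⁻ {0} {0} {xs} xs∈
    to {[]}    _ | _ = here refl
    to {_ ∷ _} _ | z≤n ∷ _ , (() ∷ _ , _) , _
    from : ∀ {xs} → xs ∈ [] ∷ [] → xs ∈ bounded 0 0
    from (here refl) = ∈-bounded⁺ {0} ([] , ([] , [] , refl) , [])
  count-zero (suc n) = cong +_ (unique⇒length-≡ {ys = []} (bounded-unique 0 (suc n)) [] to (λ ()))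
    where
    to : ∀ {xs} → xs ∈ bounded 0 (suc n) → xs ∈ []
    to {xs} xs∈ with ∈-bounded⁻ {0} {suc n} {xs} xs∈
    to {[]}    _ | _ , (_ , _ , ()) , _
    to {_ ∷ _} _ | z≤n ∷ _ , (() ∷ _ , _) , _

  IsBounded-suc : ∀ {m n xs} → IsBounded m n xs → IsBounded (suc m) n xs
  IsBounded-suc (a , v) = All.map ℕ.m≤n⇒m≤1+n a , v

  filter-tail : ∀ x ys → Unique (filter D? (x ∷ ys)) → Unique (filter D? ys)
  filter-tail x ys u with D? x
  ... | no  _ = u
  ... | yes _ = AllPairs.tail u

  linked-∷ : ∀ {x ys} → All (_≤ x) ys → Linked _≥_ ys → Linked _≥_ (x ∷ ys)
  linked-∷ []         []         = [-]
  linked-∷ (y≤x ∷ _) l          = y≤x ∷ l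

  linked-bound : ∀ {x ys} → Linked _≥_ (x ∷ ys) → All (_≤ x) ys
  linked-bound l with Linked⇒AllPairs (λ p q → ℕ.≤-trans q p) l
  ... | a ∷ _ = a

  linked-tail : ∀ {x ys} → Linked _≥_ (x ∷ ys) → Linked _≥_ ys
  linked-tail [-]     = []
  linked-tail (_ ∷ l) = l

  -- After a part suc m the remaining parts are bounded by m′, the value
  -- of which depends on whether suc m may be repeated.
  module _ (m m′ : ℕ) (m′≤ : m′ ≤ suc m)
    (tail⁻ : ∀ {ys} → Unique (filter D? (suc m ∷ ys)) → All (_≤ suc m) ys → All (_≤ m′) ys)
    (tail⁺ : ∀ {ys} → All (_≤ m′) ys → Unique (filter D? ys) → Unique (filter D? (suc m ∷ ys)))
    where

    IsBounded-∷ : ∀ {n ys} → IsBounded m′ n ys → IsBounded (suc m) (suc m ℕ.+ n) (suc m ∷ ys)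
    IsBounded-∷ (a , (pos , l , refl) , u) =
      ℕ.≤-refl ∷ a′ , (s≤s z≤n ∷ pos , linked-∷ a′ l , refl) , tail⁺ a u
      where
      a′ = All.map (λ y≤ → ℕ.≤-trans y≤ m′≤) a

    -- Parts are weakly decreasing, so the head decides: if it is at most m, so is everything after
    -- it; otherwise it is `suc m` and can be removed.
    IsBounded-cases : ∀ {n xs} → IsBounded (suc m) n xs →
      IsBounded m n xs ⊎
      (∃[ ys ] ∃[ n′ ] n ≡ suc m ℕ.+ n′ × xs ≡ suc m ∷ ys × IsBounded m′ n′ ys)
    IsBounded-cases {xs = []} (_ , v) = inj₁ ([] , v)
    IsBounded-cases {xs = x ∷ ys} (x≤ ∷ a , v@((_ ∷ pos , l , e) , u)) with ℕ.m≤n⇒m<n∨m≡n x≤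
    ... | inj₁ (s≤s x≤m) = inj₁ (x≤m ∷ All.map (λ y≤ → ℕ.≤-trans y≤ x≤m) (linked-bound l) , v)
    ... | inj₂ refl = inj₂ (ys , sum ys , sym e , refl ,
            tail⁻ u a , (pos , linked-tail l , refl) , filter-tail x ys u)

    count-recurrence : count (suc m) ≗ count m ⊕ shift (suc m) (count m′)
    count-recurrence n with ℕ.<-≤-connex n (suc m)
    ... | inj₁ n≤m = trans
      (cong +_ (unique⇒length-≡ (bounded-unique (suc m) n) (bounded-unique m n) to
        (λ xs∈ → ∈-bounded⁺ (IsBounded-suc (∈-bounded⁻ {m} {n} xs∈)))))
      (sym (trans (cong (λ z → count m n ℤ.+ z) (shift-< (count m′) n≤m)) (ℤ.+-identityʳ _)))
      where
      to : ∀ {xs} → xs ∈ bounded (suc m) n → xs ∈ bounded m n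
      to xs∈ with IsBounded-cases {n} (∈-bounded⁻ {suc m} {n} xs∈)
      ... | inj₁ b = ∈-bounded⁺ b
      ... | inj₂ (_ , n′ , refl , _) = contradiction n≤m (ℕ.≤⇒≯ (ℕ.m≤m+n (suc m) n′))
    ... | inj₂ m<n with n′ , refl ← ℕ.m≤n⇒∃[o]m+o≡n m<n = begin
      + length (bounded (suc m) n)
        ≡⟨ cong +_ (unique⇒length-≡ (bounded-unique (suc m) n)
             (++⁺ (bounded-unique m n) (map⁺ ∷-injectiveʳ (bounded-unique m′ n′)) disjoint) to from) ⟩
      + length (bounded m n ++ map (suc m ∷_) (bounded m′ n′))
        ≡⟨ cong +_ (trans (length-++ (bounded m n)) (cong (length (bounded m n) ℕ.+_) (length-map _ (bounded m′ n′)))) ⟩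
      count m n ℤ.+ count m′ n′
        ≡⟨ cong (λ z → count m n ℤ.+ z) (shift-+ (suc m) (count m′) n′) ⟨
      count m n ℤ.+ shift (suc m) (count m′) n ∎
      where
      open ≡.≡-Reasoning
      disjoint : ∀ {xs} → xs ∈ bounded m n × xs ∈ map (suc m ∷_) (bounded m′ n′) → ⊥
      disjoint (xs∈ , xs∈′) with ∈-map⁻ (suc m ∷_) xs∈′ | ∈-bounded⁻ {m} {n} xs∈
      ... | _ , _ , refl | 1+m≤m ∷ _ , _ = ℕ.<-irrefl refl 1+m≤m
      to : ∀ {xs} → xs ∈ bounded (suc m) n → xs ∈ bounded m n ++ map (suc m ∷_) (bounded m′ n′)
      to xs∈ with IsBounded-cases {n} (∈-bounded⁻ {suc m} {n} xs∈)
      ... | inj₁ b = ∈-++⁺ˡ (∈-bounded⁺ b)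
      ... | inj₂ (ys , n″ , e , refl , b) with refl ← ℕ.+-cancelˡ-≡ (suc m) n′ n″ e =
        ∈-++⁺ʳ (bounded m n) (∈-map⁺ (suc m ∷_) (∈-bounded⁺ b))
      from : ∀ {xs} → xs ∈ bounded m n ++ map (suc m ∷_) (bounded m′ n′) → xs ∈ bounded (suc m) n
      from xs∈ with ∈-++⁻ (bounded m n) xs∈
      ... | inj₁ xs∈ˡ = ∈-bounded⁺ (IsBounded-suc (∈-bounded⁻ {m} {n} xs∈ˡ))
      ... | inj₂ xs∈ʳ with ys , ys∈ , refl ← ∈-map⁻ (suc m ∷_) xs∈ʳ =
        ∈-bounded⁺ (IsBounded-∷ (∈-bounded⁻ {m′} {n′} ys∈))

  -- In generating functions this is the factor 1 + X^(m+1).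
  count-distinct : ∀ m → D (suc m) → count (suc m) ≗ count m ⊕ shift (suc m) (count m)
  count-distinct m d = count-recurrence m m (ℕ.n≤1+n m) tail⁻ tail⁺
    where
    tail⁻ : ∀ {ys} → Unique (filter D? (suc m ∷ ys)) → All (_≤ suc m) ys → All (_≤ m) ys
    tail⁻ {ys} u a with fresh ∷ _ ← subst Unique (filter-accept D? {xs = ys} d) u =
      All.tabulate λ y∈ → ℕ.≤-pred (ℕ.≤∧≢⇒< (All.lookup a y∈)
        λ { refl → All.lookup fresh (∈-filter⁺ D? y∈ d) refl })
    tail⁺ : ∀ {ys} → All (_≤ m) ys → Unique (filter D? ys) → Unique (filter D? (suc m ∷ ys))
    tail⁺ {ys} a u = subst Unique (sym (filter-accept D? {xs = ys} d))
      (All.tabulate (λ y∈ → λ { refl → ℕ.<-irrefl refl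
        (All.lookup a (proj₁ (∈-filter⁻ D? {xs = ys} y∈))) }) ∷ u)

  -- The factor 1/(1 - X^(m+1)) in implicit form, with the new series on both sides as
  -- `poch-quotient` expects.
  count-repeated : ∀ m → ¬ D (suc m) → count (suc m) ≗ count m ⊕ shift (suc m) (count (suc m))
  count-repeated m ¬d = count-recurrence m (suc m) ℕ.≤-refl (λ _ a → a)
    (λ {ys} _ u → subst Unique (sym (filter-reject D? {xs = ys} ¬d)) u)

-- Values of pod and p as shifted coefficients

pSeries podSeries : Series
pSeries   n = + length (partitions n)
podSeries n = + length (podPartitions n)

shift-⊖ : ∀ (φ : ℤ → ℕ) f → (∀ n → + φ (+ n) ≡ f n) → (∀ n → φ -[1+ n ] ≡ 0) →
  ∀ k e → + φ (k ℤ.⊖ e) ≡ shift e f k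
shift-⊖ φ f p m k       zero    = p k
shift-⊖ φ f p m zero    (suc e) = cong +_ (m e)
shift-⊖ φ f p m (suc k) (suc e) =
  trans (cong (λ z → + φ z) (ℤ.[1+m]⊖[1+n]≡m⊖n k e)) (shift-⊖ φ f p m k e)

pod-shift : ∀ k e → + pod (+ k ℤ.- + e) ≡ shift e podSeries k
pod-shift k e = trans (cong (λ z → + pod z) (ℤ.m-n≡m⊖n k e))
  (shift-⊖ pod podSeries (λ _ → refl) (λ _ → refl) k e)

p-integer : ∀ r m → toℚᵘ r ≃ mkℚᵘ (+ (m ℕ.* 4)) 3 → p r ≡ length (partitions m)
p-integer r m r≃ = cong p (ℚ.toℚᵘ-injective {r} {mkℚ (+ m) 0 (Coprime.sym (Coprime.1-coprimeTo m))}
  (ℚᵘ.≃-trans r≃ (*≡* (trans (ℤ.*-identityʳ _) (ℤ.pos-* m 4)))))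

-- dilate pSeries is n ↦ p (n / 4).
p-quarter : ∀ r n → toℚᵘ r ≃ mkℚᵘ (+ n) 3 → + p r ≡ dilate pSeries n
p-quarter r n r≃ with dilate-support pSeries n
... | inj₁ (m , refl) = trans (cong +_ (p-integer r m r≃)) (sym (dilate-*4 pSeries m))
p-quarter (mkℚ (+ _)    (suc _) _) n _ | inj₂ ≡0 = sym ≡0
p-quarter (mkℚ -[1+ _ ] (suc _) _) n _ | inj₂ ≡0 = sym ≡0
-- The type of the second alternative does not exclude that 4 divides n, so an integral r still has
-- to be evaluated, now at n = 4m.
p-quarter (mkℚ (+ m) zero _) n (*≡* e) | inj₂ ≡0 = trans
  (sym (dilate-*4 pSeries m))
  (cong (dilate pSeries) (ℤ.+-injective (trans (ℤ.pos-* m 4) (trans e (ℤ.*-identityʳ (+ n))))))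
p-quarter (mkℚ -[1+ _ ] zero _) n (*≡* e) | inj₂ ≡0 = sym ≡0

p-negative : ∀ r n → toℚᵘ r ≃ mkℚᵘ -[1+ n ] 3 → p r ≡ 0
p-negative (mkℚ (+ zero)   zero    _) n (*≡* ())
p-negative (mkℚ (+ suc _)  zero    _) n (*≡* ())
p-negative (mkℚ -[1+ _ ]   zero    _) n _ = refl
p-negative (mkℚ (+ _)      (suc _) _) n _ = refl
p-negative (mkℚ -[1+ _ ]   (suc _) _) n _ = refl

p-⊖ : ∀ k e r → toℚᵘ r ≃ mkℚᵘ (k ℤ.⊖ e) 3 → + p r ≡ shift e (dilate pSeries) k
p-⊖ k       zero    r r≃ = p-quarter r k r≃
p-⊖ zero    (suc e) r r≃ = cong +_ (p-negative r e r≃)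
p-⊖ (suc k) (suc e) r r≃ =
  p-⊖ k e r (subst (λ z → toℚᵘ r ≃ mkℚᵘ z 3) (ℤ.[1+m]⊖[1+n]≡m⊖n k e) r≃)

-- The argument t stands for j(3j + 1), which is even; with t = 2e the argument of p becomes (k -
-- e)/4, a coefficient of P(X⁴) shifted by e.
p-shift : ∀ k e t → t ≡ + 2 ℤ.* + e →
  + p ((+ k ℚ./ 4) ℚ.- (t ℚ./ 8)) ≡ shift e (dilate pSeries) k
p-shift k e t refl = p-⊖ k e ((+ k ℚ./ 4) ℚ.- (t ℚ./ 8)) (begin
  toℚᵘ ((+ k ℚ./ 4) ℚ.- (t ℚ./ 8))              ≈⟨ ℚ.toℚᵘ-homo-+ (+ k ℚ./ 4) (ℚ.- (t ℚ./ 8)) ⟩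
  toℚᵘ (+ k ℚ./ 4) ℚᵘ.+ toℚᵘ (ℚ.- (t ℚ./ 8))    ≈⟨ ℚᵘ.+-cong (ℚ.toℚᵘ-fromℚᵘ (mkℚᵘ (+ k) 3))
                                                    (ℚᵘ.≃-trans (ℚ.toℚᵘ-homo‿- (t ℚ./ 8)) (ℚᵘ.-‿cong (ℚ.toℚᵘ-fromℚᵘ (mkℚᵘ t 7)))) ⟩
  mkℚᵘ (+ k) 3 ℚᵘ.- mkℚᵘ t 7                    ≈⟨ *≡* (lemma (+ k) (+ e)) ⟩
  mkℚᵘ (+ k ℤ.- + e) 3                          ≡⟨ cong (λ z → mkℚᵘ z 3) (ℤ.m-n≡m⊖n k e) ⟩
  mkℚᵘ (k ℤ.⊖ e) 3                              ∎)
  where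
  open import Relation.Binary.Reasoning.Setoid ℚᵘ.≃-setoid
  lemma : ∀ k e → (k ℤ.* + 8 ℤ.+ ℤ.- (+ 2 ℤ.* e) ℤ.* + 4) ℤ.* + 4 ≡ (k ℤ.- e) ℤ.* + 32
  lemma = ℤ-Solver.solve-∀

-- The identity modulo X ^ suc N

module Pod = DistinctOn odd?
module Unrestricted = DistinctOn ∅?


module Truncation (N : ℕ) where

  open CommutativeRing (truncated N) using (_≈_; setoid)
  module R = CommutativeRing (truncated N)
  open Algebra.Properties.CommutativeSemiring.Exp R.commutativeSemiring
  open QSeries (truncated N)
  open import Relation.Binary.Reasoning.Setoid setoid

  X^⊛ : ∀ e f → (X ^ e) ⊛ f ≗ shift e f
  X^⊛ zero    f n       = ⊛-identityˡ f n
  X^⊛ (suc e) f zero    = refl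
  X^⊛ (suc e) f (suc n) = trans (⊛-assoc X (X ^ e) f (suc n))
    (trans (X⊛-suc ((X ^ e) ⊛ f) n) (X^⊛ e f n))

  X^[1+N]≈𝟎 : X ^ suc N ≈ 𝟎
  X^[1+N]≈𝟎 k k≤N = trans (sym (⊛-identityʳ (X ^ suc N) k))
    (trans (X^⊛ (suc N) 𝟏 k) (shift-< 𝟏 (s≤s k≤N)))

  ⊖𝟏⊛ : ∀ f → (⊖ 𝟏) ⊛ f ≗ ⊖ f
  -- The claim concerns every coefficient, including those beyond N, so the ring law is taken from
  -- the truncation at k itself.
  ⊖𝟏⊛ f k = -1*x≈-x f k ℕ.≤-refl
    where
    open import Algebra.Properties.Ring (CommutativeRing.ring (truncated k)) using (-1*x≈-x)

  [⊖𝟏]^⊛ : ∀ i f k → (((⊖ 𝟏) ^ i) ⊛ f) k ≡ (-1ℤ ℤ.^ i) ℤ.* f k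
  [⊖𝟏]^⊛ zero    f k = trans (⊛-identityˡ f k) (sym (ℤ.*-identityˡ (f k)))
  [⊖𝟏]^⊛ (suc i) f k = trans (⊛-assoc (⊖ 𝟏) ((⊖ 𝟏) ^ i) f k)
    (trans (⊖𝟏⊛ (((⊖ 𝟏) ^ i) ⊛ f) k)
    (trans (cong ℤ.-_ ([⊖𝟏]^⊛ i f k))
    (trans (sym (ℤ.-1*i≡-i _)) (sym (ℤ.*-assoc -1ℤ (-1ℤ ℤ.^ i) (f k))))))

  X² X⁴ : Series
  X² = X ⊛ X
  X⁴ = X² ⊛ X²

  X²^ : ∀ m → X² ^ m ≈ X ^ (m ℕ.* 2)
  X²^ m = begin
    (X ⊛ X) ^ m        ≈⟨ ^-congˡ m (R.*-congˡ (R.sym (R.*-identityʳ X))) ⟩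
    (X ^ 2) ^ m        ≈⟨ ^-assocʳ X 2 m ⟩
    X ^ (2 ℕ.* m)      ≡⟨ cong (X ^_) (ℕ.*-comm 2 m) ⟩
    X ^ (m ℕ.* 2)      ∎

  X⁴^ : ∀ m → X⁴ ^ m ≈ X ^ (m ℕ.* 4)
  X⁴^ m = begin
    (X² ⊛ X²) ^ m              ≈⟨ ^-distrib-* X² X² m ⟩
    (X² ^ m) ⊛ (X² ^ m)        ≈⟨ R.*-cong (X²^ m) (X²^ m) ⟩
    (X ^ (m ℕ.* 2)) ⊛ (X ^ (m ℕ.* 2))
                               ≈⟨ ^-homo-* X (m ℕ.* 2) (m ℕ.* 2) ⟨
    X ^ (m ℕ.* 2 ℕ.+ m ℕ.* 2)  ≡⟨ cong (X ^_) (sym (ℕ.*-distribˡ-+ m 2 2)) ⟩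
    X ^ (m ℕ.* 4)              ∎

  -- The generating function of pod as (-q; q²)/(q²; q²). With `c n` counting parts up to 2n, each
  -- step admits the odd part 2n + 1, at most once, and then the even part 2n + 2, repeatable: one
  -- factor for the numerator and one for the denominator.
  podSeries-poch : podSeries ⊛ poch (⊖ X²) X² (suc N) ≈ poch X X² (suc N)
  podSeries-poch = begin
    podSeries ⊛ poch (⊖ X²) X² (suc N)        ≈⟨ R.*-congʳ podSeries≈ ⟩
    c (suc N) ⊛ poch (⊖ X²) X² (suc N)        ≈⟨ poch-quotient X² c (poch X X²) (λ n → 𝟏 ⊕ X ⊛ (X² ^ n))
                                                   (λ k _ → Pod.count-zero k) (λ _ → R.refl) step (suc N) ⟩
    poch X X² (suc N)                         ∎
    where
    c : ℕ → Series
    c n = Pod.count (n ℕ.* 2)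
    podSeries≈ : podSeries ≈ c (suc N)
    podSeries≈ k k≤N = sym (Pod.count-complete
      (ℕ.≤-trans (ℕ.m≤n⇒m≤1+n k≤N) (ℕ.m≤m*n (suc N) 2))
      (podPartitions-unique k)
      (λ {xs} → Equivalence.to (∈-podPartitions k xs))
      (λ {xs} → Equivalence.from (∈-podPartitions k xs)))
    even : ∀ n → ¬ Odd (suc n ℕ.* 2)
    even n odd = odd (n∣m*n (suc n))
    odd : ∀ n → Odd (suc (n ℕ.* 2))
    odd n 2∣ with () ← ∣1⇒≡1 (∣m+n∣m⇒∣n (subst (2 ∣_) (ℕ.+-comm 1 (n ℕ.* 2)) 2∣) (n∣m*n n))
    step : ∀ n → c (suc n) ≈ c n ⊛ (𝟏 ⊕ X ⊛ (X² ^ n)) ⊕ X² ⊛ (X² ^ n) ⊛ c (suc n)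
    step n = begin
      c (suc n)
        ≈⟨ (λ k _ → Pod.count-repeated (suc (n ℕ.* 2)) (even n) k) ⟩
      Pod.count (suc (n ℕ.* 2)) ⊕ shift (suc n ℕ.* 2) (c (suc n))
        ≈⟨ R.+-cong (λ k _ → Pod.count-distinct (n ℕ.* 2) (odd n) k)
             (λ k _ → sym (X^⊛ (suc n ℕ.* 2) (c (suc n)) k)) ⟩
      (c n ⊕ shift (suc (n ℕ.* 2)) (c n)) ⊕ (X ^ (suc n ℕ.* 2)) ⊛ c (suc n)
        ≈⟨ R.+-cong (R.+-cong (R.sym (R.*-identityʳ (c n))) (λ k _ → sym (X^⊛ (suc (n ℕ.* 2)) (c n) k)))
             (R.*-congʳ (R.sym (X²^ (suc n)))) ⟩
      (c n ⊛ 𝟏 ⊕ (X ^ suc (n ℕ.* 2)) ⊛ c n) ⊕ X² ⊛ (X² ^ n) ⊛ c (suc n)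
        ≈⟨ R.+-congʳ {X² ⊛ (X² ^ n) ⊛ c (suc n)} (R.+-congˡ {c n ⊛ 𝟏}
             (R.trans (R.*-comm (X ^ suc (n ℕ.* 2)) (c n)) (R.*-congˡ {c n} (R.*-congˡ {X} (R.sym (X²^ n)))))) ⟩
      (c n ⊛ 𝟏 ⊕ c n ⊛ (X ⊛ (X² ^ n))) ⊕ X² ⊛ (X² ^ n) ⊛ c (suc n)
        ≈⟨ R.+-congʳ {X² ⊛ (X² ^ n) ⊛ c (suc n)} (R.distribˡ (c n) 𝟏 (X ⊛ (X² ^ n))) ⟨
      c n ⊛ (𝟏 ⊕ X ⊛ (X² ^ n)) ⊕ X² ⊛ (X² ^ n) ⊛ c (suc n) ∎

  -- Euler's product at X⁴: admitting the repeatable part n + 1 divides by 1 - X^(4(n+1)), and the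
  -- numerator stays 1 throughout.
  dilate-pSeries-poch : dilate pSeries ⊛ poch (⊖ X⁴) X⁴ (suc N) ≈ 𝟏
  dilate-pSeries-poch = begin
    dilate pSeries ⊛ poch (⊖ X⁴) X⁴ (suc N)   ≈⟨ R.*-congʳ pSeries≈ ⟩
    c (suc N) ⊛ poch (⊖ X⁴) X⁴ (suc N)        ≈⟨ poch-quotient X⁴ c (λ _ → 𝟏) (λ _ → 𝟏)
                                                   c₀ (λ _ → R.sym (R.*-identityˡ 𝟏)) step (suc N) ⟩
    𝟏                                         ∎
    where
    module U = Unrestricted
    c : ℕ → Series
    c n = dilate (U.count n)
    c₀ : c 0 ≈ 𝟏
    c₀ k _ = trans (dilate-cong-≤ k (λ i _ → U.count-zero i)) (dilate-𝟏 k)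
    all-distinct : ∀ xs → Unique (filter ∅? xs)
    all-distinct xs = subst Unique (sym (filter-none ∅? (All.universal (λ _ ()) xs))) []
    pSeries≈ : dilate pSeries ≈ c (suc N)
    pSeries≈ k k≤N = dilate-cong-≤ k (λ i i≤k → sym (U.count-complete
      (ℕ.m≤n⇒m≤1+n (ℕ.≤-trans i≤k k≤N))
      (partitions-unique i)
      (λ {xs} xs∈ → Equivalence.to (∈-partitions i xs) xs∈ , all-distinct xs)
      (λ {xs} v → Equivalence.from (∈-partitions i xs) (proj₁ v))))
    step : ∀ n → c (suc n) ≈ c n ⊛ 𝟏 ⊕ X⁴ ⊛ (X⁴ ^ n) ⊛ c (suc n)
    step n = begin
      c (suc n)
        ≈⟨ (λ k _ → dilate-cong-≤ k (λ i _ → U.count-repeated n (λ ()) i)) ⟩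
      dilate (U.count n ⊕ shift (suc n) (U.count (suc n)))
        ≈⟨ (λ k _ → dilate-⊕ (U.count n) (shift (suc n) (U.count (suc n))) k) ⟩
      c n ⊕ dilate (shift (suc n) (U.count (suc n)))
        ≈⟨ R.+-cong (R.sym (R.*-identityʳ (c n))) (λ k _ → dilate-shift (suc n) (U.count (suc n)) k) ⟩
      c n ⊛ 𝟏 ⊕ shift (suc n ℕ.* 4) (c (suc n))
        ≈⟨ R.+-congˡ {c n ⊛ 𝟏} (λ k _ → sym (X^⊛ (suc n ℕ.* 4) (c (suc n)) k)) ⟩
      c n ⊛ 𝟏 ⊕ (X ^ (suc n ℕ.* 4)) ⊛ c (suc n)
        ≈⟨ R.+-congˡ {c n ⊛ 𝟏} (R.*-congʳ {c (suc n)} (R.sym (X⁴^ (suc n)))) ⟩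
      c n ⊛ 𝟏 ⊕ X⁴ ⊛ (X⁴ ^ n) ⊛ c (suc n) ∎

  Σ±-coefficient : ∀ f (w⁺ w⁻ : ℕ → Series) (h : ℤ → ℤ) →
    (∀ i → (f ⊛ w⁺ i) N ≡ h (+ i)) → (∀ i → (f ⊛ w⁻ (suc i)) N ≡ h -[1+ i ]) →
    ∀ n → (f ⊛ Σ± n w⁺ w⁻) N ≡ ∑∣j∣≤ n h
  Σ±-coefficient f w⁺ w⁻ h h⁺ h⁻ zero    = h⁺ 0
  Σ±-coefficient f w⁺ w⁻ h h⁺ h⁻ (suc n) = trans (⊛-distribˡ f (Σ± n w⁺ w⁻) (w⁺ (suc n) ⊕ w⁻ (suc n)) N)
    (cong₂ ℤ._+_ (Σ±-coefficient f w⁺ w⁻ h h⁺ h⁻ n)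
      (trans (⊛-distribˡ f (w⁺ (suc n)) (w⁻ (suc n)) N) (cong₂ ℤ._+_ (h⁺ (suc n)) (h⁻ n))))

  ⊛-monomial : ∀ f {w} e → w ≈ X ^ e → (f ⊛ w) N ≡ shift e f N
  ⊛-monomial f {w} e w≈ = trans (R.*-congˡ {f} w≈ N ℕ.≤-refl)
    (trans (⊛-comm f (X ^ e) N) (X^⊛ e f N))

  ⊛-signed-monomial : ∀ f {w} i e → w ≈ ((⊖ 𝟏) ^ i) ⊛ (X ^ e) →
    (f ⊛ w) N ≡ (-1ℤ ℤ.^ i) ℤ.* shift e f N
  ⊛-signed-monomial f {w} i e w≈ = trans (R.*-congˡ {f} w≈ N ℕ.≤-refl)
    (trans (⊛-comm f (((⊖ 𝟏) ^ i) ⊛ (X ^ e)) N)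
    (trans (⊛-assoc ((⊖ 𝟏) ^ i) (X ^ e) f N)
    (trans ([⊖𝟏]^⊛ i ((X ^ e) ⊛ f) N)
    (cong (λ z → (-1ℤ ℤ.^ i) ℤ.* z) (X^⊛ e f N)))))

-- The exponents j(3j + 1)/2 and 3j²

pent : ℤ → ℕ
pent (+ i)    = triangle (suc i) ℕ.+ triangle (suc i) ℕ.+ triangle i
pent -[1+ i ] = triangle (suc i) ℕ.+ triangle (suc i) ℕ.+ triangle (suc (suc i))

-- `pent` has the shape in which `Φ-weight⁺` and `Φ-weight⁻` deliver the exponent; here that shape
-- is recognised as the generalized pentagonal number j(3j + 1)/2.
2*pent : ∀ j → j ℤ.* (+ 3 ℤ.* j ℤ.+ 1ℤ) ≡ + 2 ℤ.* + pent j
2*pent (+ i) = begin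
  I ℤ.* (+ 3 ℤ.* I ℤ.+ 1ℤ)                       ≡⟨ lemma₁ I ⟩
  + 3 ℤ.* (I ℤ.* I) ℤ.+ I                        ≡⟨ cong (λ z → + 3 ℤ.* z ℤ.+ I) (trans (sym (ℤ.pos-* i i)) (cong +_ (sym (i+2triangle i)))) ⟩
  + 3 ℤ.* (I ℤ.+ (T ℤ.+ T)) ℤ.+ I                ≡⟨ lemma₂ I T ⟩
  + 2 ℤ.* (I ℤ.+ T ℤ.+ (I ℤ.+ T) ℤ.+ T)          ∎
  where
  open ≡.≡-Reasoning
  I = + i
  T = + triangle i
  lemma₁ : ∀ I → I ℤ.* (+ 3 ℤ.* I ℤ.+ 1ℤ) ≡ + 3 ℤ.* (I ℤ.* I) ℤ.+ I
  lemma₁ = ℤ-Solver.solve-∀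
  lemma₂ : ∀ I T → + 3 ℤ.* (I ℤ.+ (T ℤ.+ T)) ℤ.+ I ≡ + 2 ℤ.* (I ℤ.+ T ℤ.+ (I ℤ.+ T) ℤ.+ T)
  lemma₂ = ℤ-Solver.solve-∀
2*pent -[1+ i ] = begin
  (ℤ.- I) ℤ.* (+ 3 ℤ.* (ℤ.- I) ℤ.+ 1ℤ)           ≡⟨ lemma₁ I ⟩
  + 3 ℤ.* (I ℤ.* I) ℤ.- I                        ≡⟨ cong (λ z → + 3 ℤ.* z ℤ.- I) (trans (sym (ℤ.pos-* (suc i) (suc i))) (cong +_ (sym (i+2triangle (suc i))))) ⟩
  + 3 ℤ.* (I ℤ.+ (T ℤ.+ T)) ℤ.- I                ≡⟨ lemma₂ I T ⟩
  + 2 ℤ.* (T ℤ.+ T ℤ.+ (I ℤ.+ T))                ∎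
  where
  open ≡.≡-Reasoning
  I = + suc i
  T = + triangle (suc i)
  lemma₁ : ∀ I → (ℤ.- I) ℤ.* (+ 3 ℤ.* (ℤ.- I) ℤ.+ 1ℤ) ≡ + 3 ℤ.* (I ℤ.* I) ℤ.- I
  lemma₁ = ℤ-Solver.solve-∀
  lemma₂ : ∀ I T → + 3 ℤ.* (I ℤ.+ (T ℤ.+ T)) ℤ.- I ≡ + 2 ℤ.* (T ℤ.+ T ℤ.+ (I ℤ.+ T))
  lemma₂ = ℤ-Solver.solve-∀

∣j∣≤pent : ∀ j → ∣ j ∣ ≤ pent j
∣j∣≤pent (+ i)    = ℕ.≤-trans (ℕ.m≤m+n i (triangle i))
  (ℕ.≤-trans (ℕ.m≤m+n _ (triangle (suc i))) (ℕ.m≤m+n _ (triangle i)))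
∣j∣≤pent -[1+ i ] = ℕ.≤-trans (ℕ.m≤m+n (suc i) (triangle (suc i)))
  (ℕ.m≤n+m _ (triangle (suc i) ℕ.+ triangle (suc i)))

3j² : ∀ j → + 3 ℤ.* (j ℤ.* j) ≡ + (3 ℕ.* (∣ j ∣ ℕ.* ∣ j ∣))
3j² (+ i)    = trans (cong (λ z → + 3 ℤ.* z) (sym (ℤ.pos-* i i))) (sym (ℤ.pos-* 3 (i ℕ.* i)))
3j² -[1+ i ] = refl

i≤3i² : ∀ i → i ≤ 3 ℕ.* (i ℕ.* i)
i≤3i² zero      = z≤n
i≤3i² i@(suc _) = ℕ.≤-trans (ℕ.m≤m*n i i) (ℕ.m≤n*m (i ℕ.* i) 3)

-- The bilateral sums as coefficients of X^n

open import Data.Integer using (_+_; _-_; _*_)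

theorem4p11 : ∀ (n : ℕ) →
    ∃[ s ] ((∑ℤ (λ j → (-1^ j) * + pod (+ n - + 3 * (j * j))) ≈ s)
    × (∑ℤ (λ j → + p ((+ n ℚ./ 4) ℚ.- ((j * (+ 3 * j + 1ℤ)) ℚ./ 8))) ≈ s))
theorem4p11 n = ∑∣j∣≤ (suc n) podTerm
  -- Both exponents are at least |j|, so terms with |j| > n already vanish; the cutoff `suc n` is
  -- chosen because it is the nilpotency exponent of X, hence the length of the finite theta sums.
  , (suc n , podTerm-vanishes , refl)
  , (suc n , pTerm-vanishes , sym sums-agree)
  where
  open Truncation n
  open QSeries (truncated n)
  podTerm pTerm : ℤ → ℤ
  podTerm j = (-1^ j) * + pod (+ n - + 3 * (j * j))
  pTerm   j = + p ((+ n ℚ./ 4) ℚ.- ((j * (+ 3 * j + 1ℤ)) ℚ./ 8))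

  podTerm-shift : ∀ j → podTerm j ≡ (-1^ j) * shift (3 ℕ.* (∣ j ∣ ℕ.* ∣ j ∣)) podSeries n
  podTerm-shift j = cong (λ z → (-1^ j) * z)
    (trans (cong (λ z → + pod (+ n - z)) (3j² j)) (pod-shift n (3 ℕ.* (∣ j ∣ ℕ.* ∣ j ∣))))

  pTerm-shift : ∀ j → pTerm j ≡ shift (pent j) (dilate pSeries) n
  pTerm-shift j = p-shift n (pent j) (j * (+ 3 * j + 1ℤ)) (2*pent j)

  podTerm-vanishes : ∀ j → suc n < ∣ j ∣ → podTerm j ≡ 0ℤ
  podTerm-vanishes j n<∣j∣ = trans (podTerm-shift j)
    (trans (cong (λ z → (-1^ j) * z)
      (shift-< podSeries (ℕ.<-≤-trans (ℕ.<-trans (ℕ.n<1+n n) n<∣j∣) (i≤3i² ∣ j ∣))))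
    (ℤ.*-zeroʳ (-1^ j)))

  pTerm-vanishes : ∀ j → suc n < ∣ j ∣ → pTerm j ≡ 0ℤ
  pTerm-vanishes j n<∣j∣ = trans (pTerm-shift j)
    (shift-< (dilate pSeries) (ℕ.<-≤-trans (ℕ.<-trans (ℕ.n<1+n n) n<∣j∣) (∣j∣≤pent j)))

  sums-agree : ∑∣j∣≤ (suc n) podTerm ≡ ∑∣j∣≤ (suc n) pTerm
  sums-agree = trans (sym podSum)
    -- The final arguments read off the coefficient of X^n, the last one that the truncated ring
    -- retains.
    (trans (series-identity X (suc n) X^[1+N]≈𝟎 podSeries (dilate pSeries) podSeries-poch dilate-pSeries-poch n ℕ.≤-refl)
    pSum)
    where
    podSum = Σ±-coefficient podSeries _ _ podTerm
      (λ i → trans (⊛-signed-monomial podSeries i (3 ℕ.* (i ℕ.* i)) (Θ-weight⁺ X (suc n) X^[1+N]≈𝟎 i)) (sym (podTerm-shift (+ i))))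
      (λ i → trans (⊛-signed-monomial podSeries (suc i) (3 ℕ.* (suc i ℕ.* suc i)) (Θ-weight⁻ X (suc n) X^[1+N]≈𝟎 (suc i))) (sym (podTerm-shift -[1+ i ])))
      (suc n)
    pSum = Σ±-coefficient (dilate pSeries) _ _ pTerm
      (λ i → trans (⊛-monomial (dilate pSeries) (pent (+ i)) (Φ-weight⁺ X (suc n) X^[1+N]≈𝟎 i)) (sym (pTerm-shift (+ i))))
      (λ i → trans (⊛-monomial (dilate pSeries) (pent -[1+ i ]) (Φ-weight⁻ X (suc n) X^[1+N]≈𝟎 (suc i))) (sym (pTerm-shift -[1+ i ])))
      (suc n)
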